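{- Let $n,m,t,a,r$ be positive integers with $m\ge 2$, $t\ge 3$, $2\le a\le \min\{m,t-1\}$ and $r=mt-a$. Define $$d:=\left\lceil\frac{(m-1)(r-1)n}{mt-2}\right\rceil,\qquad s:=\left\lfloor\frac{d}{m-1}\right\rfloor,\qquad T:=d-(m-1)s,\qquad H:=n+td+(t-2)s-rn,$$ and let $\varepsilon=1$ if $H<0$, or if $H=0$ and $(n-s)\nmid T$; let $\varepsilon=0$ otherwise. If $$(r-1)n-d-\varepsilon\ \ge\ \left\lfloor\frac{3t-4}{3t-1}\,rn\right\rfloor,$$ then $$f(n,r,t+1)=(r-1)n-d-\varepsilon.$$
   Context: A balanced $r$-partite graph with parts of size $n$ is a simple graph whose vertex set is partitioned into $r$ independent sets, each of size $n$. $f(n,r,t+1)$ denotes the largest possible minimum degree of a balanced $r$-partite graph with parts of size $n$ containing no copy of the complete graph $K_{t+1}$. -}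

module Defs where

open import Data.Bool using (if_then_else_)
open import Data.Fin using (Fin; _≟_)
open import Data.Fin.Subset using (Subset; ∣_∣)
open import Data.Integer as ℤ using (ℤ; +_; 0ℤ; 1ℤ; _+_; _-_; _*_; _<?_)
open import Data.Integer.Divisibility.Signed using (_∣?_)
open import Data.Nat as ℕ using (ℕ; NonZero; >-nonZero; s≤s; z≤n)
import Data.Nat.Properties as ℕ
open import Data.Product using (Σ-syntax; ∃-syntax; _×_)
open import Data.Rational.Unnormalised using (_/_; floor; ceiling)
open import Data.Vec using (tabulate)
open import Level using (0ℓ)
open import Relation.Binary using (Rel; Symmetric; Irreflexive; Decidable)
open import Relation.Binary.PropositionalEquality using (_≡_; _≢_)
open import Relation.Nullary using (¬_; does; ¬?; _×-dec_; _⊎-dec_)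

-- Adjacency is required to be decidable so that degrees can be computed.
record SimpleGraph (N : ℕ) : Set₁ where
  infix 4 _~_ _~?_
  field
    _~_    : Rel (Fin N) 0ℓ
    sym    : Symmetric _~_
    irrefl : Irreflexive _≡_ _~_
    _~?_   : Decidable _~_

  neighbours : Fin N → Subset N
  neighbours u = tabulate λ v → does (u ~? v)

  degree : Fin N → ℕ
  degree u = ∣ neighbours u ∣

open SimpleGraph using (degree)

-- No minimum degree is assigned to the graph without vertices.
IsMinDegree : ∀ {N} → SimpleGraph N → ℕ → Set
IsMinDegree G δ = (∃[ v ] degree G v ≡ δ) × (∀ v → δ ℕ.≤ degree G v)

-- A copy of K_k.  The map is automatically injective, as adjacency is
-- irreflexive.
Clique : ∀ {N} → ℕ → SimpleGraph N → Set
Clique {N} k G = Σ[ c ∈ (Fin k → Fin N) ] (∀ i j → i ≢ j → c i ~ c j)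
  where open SimpleGraph G

record BalancedPartition {N} (n r : ℕ) (G : SimpleGraph N) : Set where
  open SimpleGraph G
  field
    part        : Fin N → Fin r
    independent : ∀ {u v} → part u ≡ part v → ¬ (u ~ v)
    size        : ∀ i → ∣ tabulate (λ v → does (part v ≟ i)) ∣ ≡ n

-- δ is the minimum degree of some K_k-free balanced r-partite graph with
-- parts of size n.
Attained : (n r k δ : ℕ) → Set₁
Attained n r k δ =
  ∃[ N ] Σ[ G ∈ SimpleGraph N ]
    BalancedPartition n r G × ¬ Clique k G × IsMinDegree G δ

-- f(n,r,k) = F.
f[_,_,_]≡_ : (n r k F : ℕ) → Set₁
f[ n , r , k ]≡ F = Attained n r k F × (∀ δ → Attained n r k δ → δ ℕ.≤ F)

-- All arithmetic is in ℤ, so that subtraction is not truncated; only the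
-- denominators m ∸ 1, m * t ∸ 2 and 3 * t ∸ 1, which are positive here, use
-- natural subtraction.
module Parameters (n m t r : ℕ) (2≤m : 2 ℕ.≤ m) (3≤t : 3 ℕ.≤ t) where

  private instance
    m∸1≢0 : NonZero (m ℕ.∸ 1)
    m∸1≢0 = >-nonZero (ℕ.m<n⇒0<n∸m 2≤m)

    mt∸2≢0 : NonZero (m ℕ.* t ℕ.∸ 2)
    mt∸2≢0 = >-nonZero (ℕ.m<n⇒0<n∸m
      (ℕ.≤-trans (s≤s (s≤s (s≤s z≤n))) (ℕ.*-mono-≤ 2≤m 3≤t)))

    3t∸1≢0 : NonZero (3 ℕ.* t ℕ.∸ 1)
    3t∸1≢0 = >-nonZero (ℕ.m<n⇒0<n∸m
      (ℕ.≤-trans (s≤s (s≤s z≤n)) (ℕ.*-monoʳ-≤ 3 3≤t)))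

  d : ℤ
  d = ceiling (((+ m - 1ℤ) * (+ r - 1ℤ) * + n) / (m ℕ.* t ℕ.∸ 2))

  s : ℤ
  s = floor (d / (m ℕ.∸ 1))

  T : ℤ
  T = d - (+ m - 1ℤ) * s

  H : ℤ
  H = + n + + t * d + (+ t - + 2) * s - + r * + n

  ε : ℤ
  ε = if does (H <? 0ℤ ⊎-dec (H ℤ.≟ 0ℤ ×-dec ¬? ((+ n - s) ∣? T)))
      then 1ℤ else 0ℤ

  threshold : ℤ
  threshold = floor (((+ 3 * + t - + 4) * (+ r * + n)) / (3 ℕ.* t ℕ.∸ 1))

{-# OPTIONS --safe #-}

-- Let D = (r − 1) n − δ for a graph with minimum degree δ.
--
-- Upper bound.  Above the threshold, the Andrásfai–Erdős–Sós theorem makes a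
-- K_{t+1}-free graph t-colourable.  Let x_{ij} count the vertices of part i and
-- colour j, and let c_j = Σ_i x_{ij}.  The degree condition says that
-- c_j ≤ D + x_{ij} whenever x_{ij} > 0.  If D < (m − 1) n, averaging gives a
-- colour with c_j > (m − 1) n; such a class meets at least m parts, which forces
-- c_j ≤ D + s, so all classes have size at most D + s.  Moreover such a class
-- shares a part with another one, and two classes that share a part have at
-- most 2D + n vertices together.  Summing, r n ≤ n + t D + (t − 2) s, that is,
-- H ≥ 0.  When H = 0 all of this is tight, and a third class is cut into pieces
-- of size n and s, which yields (n − s) ∣ T.
--
-- Lower bound.  Split (t − 1) m of the parts into a piece of size about s and a
-- remainder; m pieces form each of t − 1 colour classes, and the remainders
-- together with the uncut parts form the last class.
--
-- Andrásfai–Erdős–Sós is proved by saturating the graph.  Either non-adjacency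
-- becomes transitive and the graph is complete multipartite, or there is a
-- vertex x adjacent to neither end of an edge yz, together with cliques K ∪ Q
-- and K ∪ R in the common neighbourhoods of x, y and of x, z.  With weights |Q|
-- on x, 3 on K and 1 on the other vertices, every vertex sees weight at most
-- 3t − 4 out of 3t − 1, unless it can be moved into K.
module Submission where

open import Defs
open import Algebra.Properties.Semiring.Sum as Sum using ()
open import Data.Bool using (Bool; true; false; if_then_else_)
open import Data.Fin as Fin using (Fin; zero; suc; toℕ; _↑ˡ_; _↑ʳ_; combine; remQuot; splitAt)
open import Data.Fin.Properties as Fin using (any?)
open import Data.Fin.Subset using (∣_∣)
open import Data.List as List
  using (List; []; _∷_; length; filter; take; lookup; _++_; allFin; cartesianProduct)
import Data.List.Membership.DecPropositional as DecMembership
open import Data.List.Membership.Propositional using (_∈_)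
open import Data.List.Membership.Propositional.Properties
  using (∈-allFin; ∈-cartesianProduct⁺; ∈-filter⁻; ∈-lookup)
import Data.List.Properties as List
open import Data.List.Relation.Unary.All as All using (All; []; _∷_)
import Data.List.Relation.Unary.All.Properties as All
open import Data.List.Relation.Unary.AllPairs as AllPairs using (AllPairs; []; _∷_)
import Data.List.Relation.Unary.AllPairs.Properties as AllPairs
open import Data.List.Relation.Unary.Any as Any using (Any; here; there)
import Data.List.Relation.Unary.Any.Properties as Any
open import Data.Nat
open import Data.Nat.Divisibility using (_∣_; divides; 1∣_; _∣?_)
open import Data.Nat.DivMod
open import Data.Nat.Properties
open import Data.Nat.Tactic.RingSolver
open import Data.Product
open import Data.Rational.Unnormalised as ℚᵘ using (floor; ceiling)
open import Data.Sum using (_⊎_; inj₁; inj₂; [_,_]′)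
open import Data.Vec as Vec using ()
open import Function using (_∘_)
open import Relation.Binary.Definitions using (tri<; tri≈; tri>)
open import Relation.Binary.PropositionalEquality
open import Relation.Nullary
open import Relation.Nullary.Decidable using (dec-true; dec-false; map′; decidable-stable)
open import Relation.Unary using (Decidable)

open Sum +-*-semiring
  using (sum; sum-cong-≗; ∑-distrib-+; ∑-comm; *-distribˡ-sum; *-distribʳ-sum)

-- The certificate format for linear inequalities: a combination L ≤ U of the
-- hypotheses, and an identity checked by the ring solver.
linear : ∀ {L U a b} k → L ≤ U → a + U + k ≡ b + L → a ≤ b
linear {L} {U} {a} {b} k L≤U eq = +-cancelʳ-≤ L a b (begin
  a + L      ≤⟨ +-monoʳ-≤ a L≤U ⟩
  a + U      ≤⟨ m≤m+n (a + U) k ⟩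
  a + U + k  ≡⟨ eq ⟩
  b + L      ∎)
  where open ≤-Reasoning

infixr 6 _⊕_
infixr 7 _⊛_

_⊕_ : ∀ {a b c d} → a ≤ b → c ≤ d → a + c ≤ b + d
_⊕_ = +-mono-≤

_⊛_ : ∀ k {a b} → a ≤ b → k * a ≤ k * b
_⊛_ = *-monoʳ-≤

-- Indicators and finite sums

⟦_⟧ : Bool → ℕ
⟦ b ⟧ = if b then 1 else 0

⟦⟧≤1 : ∀ b → ⟦ b ⟧ ≤ 1
⟦⟧≤1 false = z≤n
⟦⟧≤1 true  = s≤s z≤n

⟦yes⟧ : ∀ {p} {P : Set p} (P? : Dec P) → P → ⟦ does P? ⟧ ≡ 1
⟦yes⟧ P? p = cong ⟦_⟧ (dec-true P? p)

⟦no⟧ : ∀ {p} {P : Set p} (P? : Dec P) → ¬ P → ⟦ does P? ⟧ ≡ 0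
⟦no⟧ P? ¬p = cong ⟦_⟧ (dec-false P? ¬p)

⟦⟧-cong : ∀ {p q} {P : Set p} {Q : Set q} (P? : Dec P) (Q? : Dec Q) →
  (P → Q) → (Q → P) → ⟦ does P? ⟧ ≡ ⟦ does Q? ⟧
⟦⟧-cong (yes p) Q? f g = sym (⟦yes⟧ Q? (f p))
⟦⟧-cong (no ¬p) Q? f g = sym (⟦no⟧ Q? (¬p ∘ g))

size-tabulate : ∀ {n} (f : Fin n → Bool) →
  ∣ Vec.tabulate f ∣ ≡ sum (λ i → ⟦ f i ⟧)
size-tabulate {zero}  f = refl
size-tabulate {suc n} f with f zero
... | true  = cong suc (size-tabulate (f ∘ suc))
... | false = size-tabulate (f ∘ suc)

sum-mono : ∀ {n} {f g : Fin n → ℕ} → (∀ i → f i ≤ g i) → sum f ≤ sum g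
sum-mono {zero}  f≤g = z≤n
sum-mono {suc n} f≤g = +-mono-≤ (f≤g zero) (sum-mono (f≤g ∘ suc))

sum-const : ∀ n c → sum {n} (λ _ → c) ≡ n * c
sum-const zero    c = refl
sum-const (suc n) c = cong (c +_) (sum-const n c)

sum-zero : ∀ {n} {f : Fin n → ℕ} → (∀ i → f i ≡ 0) → sum f ≡ 0
sum-zero {n} f≡0 = trans (sum-cong-≗ f≡0) (trans (sum-const n 0) (*-zeroʳ n))

term≤sum : ∀ {n} (f : Fin n → ℕ) i → f i ≤ sum f
term≤sum f zero    = m≤m+n _ _
term≤sum f (suc i) = ≤-trans (term≤sum (f ∘ suc) i) (m≤n+m _ (f zero))

two-terms≤sum : ∀ {n} (f : Fin n → ℕ) {i j} → i ≢ j → f i + f j ≤ sum f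
two-terms≤sum f {zero}  {zero}  i≢j = contradiction refl i≢j
two-terms≤sum f {zero}  {suc j} i≢j = +-monoʳ-≤ _ (term≤sum (f ∘ suc) j)
two-terms≤sum f {suc i} {zero}  i≢j = begin
  f (suc i) + f zero  ≡⟨ +-comm (f (suc i)) _ ⟩
  f zero + f (suc i)  ≤⟨ +-monoʳ-≤ _ (term≤sum (f ∘ suc) i) ⟩
  sum f               ∎
  where open ≤-Reasoning
two-terms≤sum f {suc i} {suc j} i≢j =
  ≤-trans (two-terms≤sum (f ∘ suc) (i≢j ∘ cong suc)) (m≤n+m _ (f zero))

three-terms≤sum : ∀ {n} (f : Fin n → ℕ) {i j k} → i ≢ j → i ≢ k → j ≢ k →
  f i + f j + f k ≤ sum f
three-terms≤sum f {zero} {zero} i≢j i≢k j≢k = contradiction refl i≢j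
three-terms≤sum f {zero} {suc j} {zero} i≢j i≢k j≢k = contradiction refl i≢k
three-terms≤sum f {zero} {suc j} {suc k} i≢j i≢k j≢k = begin
  f zero + f (suc j) + f (suc k)    ≡⟨ +-assoc (f zero) _ _ ⟩
  f zero + (f (suc j) + f (suc k))  ≤⟨ +-monoʳ-≤ _ (two-terms≤sum (f ∘ suc) (j≢k ∘ cong suc)) ⟩
  sum f                             ∎
  where open ≤-Reasoning
three-terms≤sum f {suc i} {zero} {zero} i≢j i≢k j≢k = contradiction refl j≢k
three-terms≤sum f {suc i} {zero} {suc k} i≢j i≢k j≢k = begin
  f (suc i) + f zero + f (suc k)    ≡⟨ cong (_+ f (suc k)) (+-comm (f (suc i)) _) ⟩
  f zero + f (suc i) + f (suc k)    ≡⟨ +-assoc (f zero) _ _ ⟩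
  f zero + (f (suc i) + f (suc k))  ≤⟨ +-monoʳ-≤ _ (two-terms≤sum (f ∘ suc) (i≢k ∘ cong suc)) ⟩
  sum f                             ∎
  where open ≤-Reasoning
three-terms≤sum f {suc i} {suc j} {zero} i≢j i≢k j≢k = begin
  f (suc i) + f (suc j) + f zero    ≡⟨ +-comm _ (f zero) ⟩
  f zero + (f (suc i) + f (suc j))  ≤⟨ +-monoʳ-≤ _ (two-terms≤sum (f ∘ suc) (i≢j ∘ cong suc)) ⟩
  sum f                             ∎
  where open ≤-Reasoning
three-terms≤sum f {suc i} {suc j} {suc k} i≢j i≢k j≢k =
  ≤-trans (three-terms≤sum (f ∘ suc) (i≢j ∘ cong suc) (i≢k ∘ cong suc) (j≢k ∘ cong suc))
    (m≤n+m _ (f zero))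

sum-indicator : ∀ {n} (i : Fin n) (f : Fin n → ℕ) →
  sum (λ j → ⟦ does (j Fin.≟ i) ⟧ * f j) ≡ f i
sum-indicator {suc n} zero f = trans
  (cong₂ _+_ (*-identityˡ (f zero)) (sum-zero {n} λ _ → refl)) (+-identityʳ (f zero))
sum-indicator (suc i) f = trans
  (sum-cong-≗ λ j → cong (_* f (suc j))
    (⟦⟧-cong (suc j Fin.≟ suc i) (j Fin.≟ i) Fin.suc-injective (cong suc)))
  (sum-indicator i (f ∘ suc))

sum-indicator′ : ∀ {n} (i : Fin n) (f : Fin n → ℕ) →
  sum (λ j → ⟦ does (i Fin.≟ j) ⟧ * f j) ≡ f i
sum-indicator′ i f = trans
  (sum-cong-≗ λ j → cong (_* f j) (⟦⟧-cong (i Fin.≟ j) (j Fin.≟ i) sym sym))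
  (sum-indicator i f)

sum-++ : ∀ m {n} (f : Fin (m + n) → ℕ) →
  sum f ≡ sum (λ i → f (i ↑ˡ n)) + sum (λ i → f (m ↑ʳ i))
sum-++ zero    f = refl
sum-++ (suc m) f = trans (cong (f zero +_) (sum-++ m (f ∘ suc)))
  (sym (+-assoc (f zero) _ _))

sum-splitAt : ∀ m {n} (f : Fin m ⊎ Fin n → ℕ) →
  sum (λ i → f (splitAt m i)) ≡ sum (f ∘ inj₁) + sum (f ∘ inj₂)
sum-splitAt m {n} f = trans (sum-++ m _) (cong₂ _+_
  (sum-cong-≗ λ i → cong f (Fin.splitAt-↑ˡ m i n))
  (sum-cong-≗ λ i → cong f (Fin.splitAt-↑ʳ m n i)))

sum-combine : ∀ m n (f : Fin (m * n) → ℕ) →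
  sum f ≡ sum {m} (λ i → sum {n} (λ j → f (combine i j)))
sum-combine zero    n f = refl
sum-combine (suc m) n f = trans (sum-++ n f)
  (cong (sum (λ i → f (i ↑ˡ (m * n))) +_) (sum-combine m n (λ i → f (n ↑ʳ i))))

sum-remQuot : ∀ m n (f : Fin m × Fin n → ℕ) →
  sum (λ i → f (remQuot n i)) ≡ sum {m} (λ i → sum {n} (λ j → f (i , j)))
sum-remQuot m n f = trans (sum-combine m n _)
  (sum-cong-≗ λ i → sum-cong-≗ λ j → cong f (Fin.remQuot-combine i j))

∃-minimum : ∀ {n} → 0 < n → (f : Fin n → ℕ) → ∃[ i ] ∀ j → f i ≤ f j
∃-minimum {suc zero}    _ f = zero , λ { zero → ≤-refl }
∃-minimum {suc (suc n)} _ f with ∃-minimum z<s (f ∘ suc)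
... | i , min with ≤-total (f zero) (f (suc i))
...   | inj₁ f₀≤ = zero , λ { zero → ≤-refl ; (suc j) → ≤-trans f₀≤ (min j) }
...   | inj₂ ≤f₀ = suc i , λ { zero → ≤f₀ ; (suc j) → min j }

-- The Andrásfai–Erdős–Sós theorem

-- Lists make cliques easy to concatenate, filter and truncate. The index `t` is the largest allowed
-- size, so K_{t+1} is what is forbidden.
CliqueFree : ∀ {N} → ℕ → SimpleGraph N → Set
CliqueFree t G = ∀ L → AllPairs _~_ L → length L ≤ t
  where open SimpleGraph G

degree-sum : ∀ {N} (G : SimpleGraph N) u →
  sum (λ v → ⟦ does (SimpleGraph._~?_ G v u) ⟧) ≡ SimpleGraph.degree G u
degree-sum {N} G u = trans
  (sum-cong-≗ λ v → ⟦⟧-cong (v ~? u) (u ~? v) (SimpleGraph.sym G) (SimpleGraph.sym G))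
  (sym (size-tabulate {N} _))
  where open SimpleGraph G using (_~?_)

-- Weighted degree counting around a wheel

module Adjacency {N} (G : SimpleGraph N) where
  open SimpleGraph G renaming (sym to ~-sym)

  adjacent : Fin N → List (Fin N) → ℕ
  adjacent w L = length (filter (w ~?_) L)

  adjacent≤length : ∀ w L → adjacent w L ≤ length L
  adjacent≤length w L = List.length-filter (w ~?_) L

  adjacent<length : ∀ w L → ¬ All (w ~_) L → adjacent w L < length L
  adjacent<length w L ¬all =
    List.filter-notAll (w ~?_) L (All.¬All⇒Any¬ (w ~?_) L ¬all)

  adjacent-∷ : ∀ w u L → adjacent w (u ∷ L) ≡ ⟦ does (w ~? u) ⟧ + adjacent w L
  adjacent-∷ w u L with does (w ~? u)
  ... | true  = refl
  ... | false = refl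

  double-count : ∀ {δ} → (∀ v → δ ≤ degree v) → ∀ L →
    length L * δ ≤ sum (λ w → adjacent w L)
  double-count δ≤ []      = z≤n
  double-count {δ} δ≤ (u ∷ L) = begin
    δ + length L * δ
      ≤⟨ +-mono-≤ (≤-trans (δ≤ u) (≤-reflexive (sym (degree-sum G u)))) (double-count δ≤ L) ⟩
    sum (λ w → ⟦ does (w ~? u) ⟧) + sum (λ w → adjacent w L)
      ≡⟨ ∑-distrib-+ (λ w → ⟦ does (w ~? u) ⟧) (λ w → adjacent w L) ⟨
    sum (λ w → ⟦ does (w ~? u) ⟧ + adjacent w L)
      ≡⟨ sum-cong-≗ (λ w → adjacent-∷ w u L) ⟨
    sum (λ w → adjacent w (u ∷ L)) ∎
    where open ≤-Reasoning

  -- For t = k + p + 1, two copies of K_{t+1} minus an edge, one missing xy and the other missing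
  -- xz, that share `x` and `K`. `Q` and `R` may overlap. Moving a vertex into `K` lowers `p` and
  -- raises `k`, so t stays fixed.
  record Wheel (k p : ℕ) : Set where
    field
      {x y z}  : Fin N
      K Q R    : List (Fin N)
      x≁y      : ¬ x ~ y
      x≁z      : ¬ x ~ z
      y~z      : y ~ z
      ∣K∣      : length K ≡ k
      ∣Q∣      : length Q ≡ p
      ∣R∣      : length R ≡ p
      K-clique : AllPairs _~_ K
      Q-clique : AllPairs _~_ Q
      R-clique : AllPairs _~_ R
      KQ       : All (λ u → All (u ~_) Q) K
      KR       : All (λ u → All (u ~_) R) K
      xK       : All (x ~_) K
      yK       : All (y ~_) K
      zK       : All (z ~_) K
      xQ       : All (x ~_) Q
      yQ       : All (y ~_) Q
      xR       : All (x ~_) R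
      zR       : All (z ~_) R

    weight : Fin N → ℕ
    weight w = p * ⟦ does (w ~? x) ⟧ + (⟦ does (w ~? y) ⟧ + ⟦ does (w ~? z) ⟧) +
               adjacent w Q + adjacent w R + 3 * adjacent w K

  module _ {k p} (W : Wheel k (suc p)) (free : CliqueFree (suc (k + suc p)) G) where
    open Wheel W

    -- Otherwise `w`, `y`, `K` and `L` would form a clique on k + p + 3 vertices. Here `y` plays the
    -- role of any of the three vertices `x`, `y`, `z` of the wheel, and `L` that of `Q` or `R`.
    no-extension : ∀ {w y} L → length L ≡ suc p → AllPairs _~_ L →
      All (λ u → All (u ~_) L) K → All (y ~_) K → All (y ~_) L →
      All (w ~_) K → All (w ~_) L → ¬ w ~ y
    no-extension {w} {y} L ∣L∣ L-clique KL yK yL wK wL w~y = <⇒≱ too-long (free _ clique)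
      where
      clique : AllPairs _~_ (w ∷ y ∷ K ++ L)
      clique = (w~y ∷ All.++⁺ wK wL) ∷ All.++⁺ yK yL ∷ AllPairs.++⁺ K-clique L-clique KL
      too-long : suc (k + suc p) < length (w ∷ y ∷ K ++ L)
      too-long = ≤-reflexive (cong (2 +_) (sym
        (trans (List.length-++ K) (cong₂ _+_ ∣K∣ ∣L∣))))

    extend : ∀ {w} → w ~ x → w ~ y → w ~ z → All (w ~_) K →
      adjacent w Q ≡ p → adjacent w R ≡ p → Wheel (suc k) p
    extend {w} wx wy wz wK ∣Q′∣ ∣R′∣ = record
      { K = w ∷ K ; Q = filter (w ~?_) Q ; R = filter (w ~?_) R
      ; x≁y = x≁y ; x≁z = x≁z ; y~z = y~z
      ; ∣K∣ = cong suc ∣K∣ ; ∣Q∣ = ∣Q′∣ ; ∣R∣ = ∣R′∣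
      ; K-clique = wK ∷ K-clique
      ; Q-clique = AllPairs.filter⁺ (w ~?_) Q-clique
      ; R-clique = AllPairs.filter⁺ (w ~?_) R-clique
      ; KQ = All.all-filter (w ~?_) Q ∷ All.map (All.filter⁺ (w ~?_)) KQ
      ; KR = All.all-filter (w ~?_) R ∷ All.map (All.filter⁺ (w ~?_)) KR
      ; xK = ~-sym wx ∷ xK ; yK = ~-sym wy ∷ yK ; zK = ~-sym wz ∷ zK
      ; xQ = All.filter⁺ (w ~?_) xQ ; yQ = All.filter⁺ (w ~?_) yQ
      ; xR = All.filter⁺ (w ~?_) xR ; zR = All.filter⁺ (w ~?_) zR
      }

    private
      Q≤ : ∀ w → adjacent w Q ≤ suc p
      Q≤ w = ≤-trans (adjacent≤length w Q) (≤-reflexive ∣Q∣)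

      R≤ : ∀ w → adjacent w R ≤ suc p
      R≤ w = ≤-trans (adjacent≤length w R) (≤-reflexive ∣R∣)

      K≤ : ∀ w → adjacent w K ≤ k
      K≤ w = ≤-trans (adjacent≤length w K) (≤-reflexive ∣K∣)

      Q< : ∀ w → ¬ All (w ~_) Q → adjacent w Q ≤ p
      Q< w ¬all = s≤s⁻¹ (≤-trans (adjacent<length w Q ¬all) (≤-reflexive ∣Q∣))

      R< : ∀ w → ¬ All (w ~_) R → adjacent w R ≤ p
      R< w ¬all = s≤s⁻¹ (≤-trans (adjacent<length w R ¬all) (≤-reflexive ∣R∣))

    -- With t = k + p + 2 the bound is 3t - 4, three below the total weight. Missing a vertex of `K`
    -- already costs 3. If `w` sees `K` but not `x`, it also loses at least 1 among `y` and `Q`, and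
    -- at least 1 among `z` and `R`. If `w` sees `K` and `x`, it misses an entry of `Q` and one of
    -- `R`; a third miss gives the bound, and without one `w` can join `K`.
    weight≤⊎extend : ∀ w → weight w ≤ 3 * k + 3 * p + 2 ⊎ Wheel (suc k) p
    weight≤⊎extend w with All.all? (w ~?_) K
    ... | no ¬wK = inj₁ (linear 0
            ((suc p ⊛ ⟦⟧≤1 (does (w ~? x))) ⊕ ⟦⟧≤1 (does (w ~? y)) ⊕ ⟦⟧≤1 (does (w ~? z)) ⊕
             Q≤ w ⊕ R≤ w ⊕ (3 ⊛ ≤-trans (adjacent<length w K ¬wK) (≤-reflexive ∣K∣)))
            (identity k p ⟦ does (w ~? x) ⟧ ⟦ does (w ~? y) ⟧ ⟦ does (w ~? z) ⟧
              (adjacent w Q) (adjacent w R) (adjacent w K)))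
      where
      identity : ∀ k p X Y Z a b c →
        suc p * X + (Y + Z) + a + b + 3 * c + (suc p * 1 + (1 + (1 + (suc p + (suc p + 3 * k))))) + 0
        ≡ 3 * k + 3 * p + 2 + (suc p * X + (Y + (Z + (a + (b + 3 * suc c)))))
      identity = solve-∀
    ... | yes wK with w ~? x
    ...   | no w≁x = inj₁ (linear p
            (side Q ∣Q∣ Q-clique KQ yK yQ ⊕ side R ∣R∣ R-clique KR zK zR ⊕ (3 ⊛ K≤ w))
            (identity k p ⟦ does (w ~? y) ⟧ ⟦ does (w ~? z) ⟧
              (adjacent w Q) (adjacent w R) (adjacent w K)))
      where
      side : ∀ {y} L → length L ≡ suc p → AllPairs _~_ L → All (λ u → All (u ~_) L) K →
        All (y ~_) K → All (y ~_) L → ⟦ does (w ~? y) ⟧ + adjacent w L ≤ suc p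
      side {y} L ∣L∣ L-clique KL yK yL with w ~? y
      ... | no _ = ≤-trans (adjacent≤length w L) (≤-reflexive ∣L∣)
      ... | yes w~y = ≤-trans
              (adjacent<length w L λ wL → no-extension L ∣L∣ L-clique KL yK yL wK wL w~y)
              (≤-reflexive ∣L∣)
      identity : ∀ k p Y Z a b c →
        suc p * 0 + (Y + Z) + a + b + 3 * c + (suc p + (suc p + 3 * k)) + p
        ≡ 3 * k + 3 * p + 2 + (Y + a + (Z + b + 3 * c))
      identity = solve-∀
    ...   | yes w~x = neighbour (w ~? y) (w ~? z)
      where
      ¬wQ : ¬ All (w ~_) Q
      ¬wQ wQ = no-extension Q ∣Q∣ Q-clique KQ xK xQ wK wQ w~x
      ¬wR : ¬ All (w ~_) R
      ¬wR wR = no-extension R ∣R∣ R-clique KR xK xR wK wR w~x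
      a = adjacent w Q
      b = adjacent w R
      c = adjacent w K
      identity : ∀ k p u a b c l →
        suc p * 1 + u + a + b + 3 * c + (l + 3 * k) + 0 ≡ suc p + l + 3 * k + (u + a + b + 3 * c)
      identity = solve-∀
      bound : ∀ u → u + a + b ≤ 2 * p + 1 → suc p * 1 + u + a + b + 3 * c ≤ 3 * k + 3 * p + 2
      bound u h = ≤-trans
        (linear 0 (h ⊕ (3 ⊛ K≤ w)) (identity k p u a b c (2 * p + 1)))
        (≤-reflexive (total k p))
        where
        total : ∀ k p → suc p + (2 * p + 1) + 3 * k ≡ 3 * k + 3 * p + 2
        total = solve-∀
      two : ∀ p → p + p ≡ 2 * p
      two = solve-∀
      neighbour : ∀ (y? : Dec (w ~ y)) (z? : Dec (w ~ z)) →
        suc p * 1 + (⟦ does y? ⟧ + ⟦ does z? ⟧) + a + b + 3 * c ≤ 3 * k + 3 * p + 2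
        ⊎ Wheel (suc k) p
      neighbour (no _) z? = inj₁ (bound _ (linear 0
        (⟦⟧≤1 (does z?) ⊕ Q< w ¬wQ ⊕ R< w ¬wR) (eq p ⟦ does z? ⟧ a b)))
        where
        eq : ∀ p u a b → u + a + b + (1 + (p + p)) + 0 ≡ 2 * p + 1 + (u + (a + b))
        eq = solve-∀
      neighbour (yes _) (no _) = inj₁ (bound _ (linear 0 (Q< w ¬wQ ⊕ R< w ¬wR) (eq p a b)))
        where
        eq : ∀ p a b → 1 + a + b + (p + p) + 0 ≡ 2 * p + 1 + (a + b)
        eq = solve-∀
      neighbour (yes w~y) (yes w~z) with a ≟ p | b ≟ p
      ... | yes a≡p | yes b≡p = inj₂ (extend w~x w~y w~z wK a≡p b≡p)
      ... | no a≢p | _ = inj₁ (bound 2 (linear 0 (≤∧≢⇒< (Q< w ¬wQ) a≢p ⊕ R< w ¬wR) (eq p a b)))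
        where
        eq : ∀ p a b → 2 + a + b + (p + p) + 0 ≡ 2 * p + 1 + (suc a + b)
        eq = solve-∀
      ... | yes _ | no b≢p = inj₁ (bound 2 (linear 0 (Q< w ¬wQ ⊕ ≤∧≢⇒< (R< w ¬wR) b≢p) (eq p a b)))
        where
        eq : ∀ p a b → 2 + a + b + (p + p) + 0 ≡ 2 * p + 1 + (a + suc b)
        eq = solve-∀

  -- Double counting: the sum over all `w` is the sum of the degrees of the wheel's vertices, each
  -- times its weight. The weights add up to p + 2 + 2p + 3k.
  weight-sum : ∀ {k p δ} (W : Wheel k p) → (∀ v → δ ≤ degree v) →
    (3 * (k + p) + 2) * δ ≤ sum (Wheel.weight W)
  weight-sum {k} {p} {δ} W δ≤ = begin
    (3 * (k + p) + 2) * δ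
      ≡⟨ identity k p δ ⟩
    p * δ + (δ + δ) + p * δ + p * δ + 3 * (k * δ)
      ≤⟨ ((((p ⊛ vertex x) ⊕ (vertex y ⊕ vertex z)) ⊕ list Q ∣Q∣) ⊕ list R ∣R∣) ⊕ (3 ⊛ list K ∣K∣) ⟩
    p * sum X + (sum Y + sum Z) + sum a + sum b + 3 * sum c
      ≡⟨ cong₂ (λ u v → u + sum a + sum b + v)
           (trans (cong₂ _+_ (*-distribˡ-sum p X) (sym (∑-distrib-+ Y Z))) (sym (∑-distrib-+ {N} _ _)))
           (*-distribˡ-sum 3 c) ⟩
    sum (λ w → p * X w + (Y w + Z w)) + sum a + sum b + sum (λ w → 3 * c w)
      ≡⟨ cong (λ u → u + sum b + sum (λ w → 3 * c w)) (∑-distrib-+ {N} _ a) ⟨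
    sum (λ w → p * X w + (Y w + Z w) + a w) + sum b + sum (λ w → 3 * c w)
      ≡⟨ cong (_+ sum (λ w → 3 * c w)) (∑-distrib-+ {N} _ b) ⟨
    sum (λ w → p * X w + (Y w + Z w) + a w + b w) + sum (λ w → 3 * c w)
      ≡⟨ ∑-distrib-+ {N} _ (λ w → 3 * c w) ⟨
    sum weight ∎
    where
    open ≤-Reasoning
    open Wheel W
    X = λ w → ⟦ does (w ~? x) ⟧
    Y = λ w → ⟦ does (w ~? y) ⟧
    Z = λ w → ⟦ does (w ~? z) ⟧
    a = λ w → adjacent w Q
    b = λ w → adjacent w R
    c = λ w → adjacent w K
    identity : ∀ k p δ → (3 * (k + p) + 2) * δ ≡ p * δ + (δ + δ) + p * δ + p * δ + 3 * (k * δ)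
    identity = solve-∀
    vertex : ∀ u → δ ≤ sum (λ w → ⟦ does (w ~? u) ⟧)
    vertex u = ≤-trans (δ≤ u) (≤-reflexive (sym (degree-sum G u)))
    list : ∀ L {l} → length L ≡ l → l * δ ≤ sum (λ w → adjacent w L)
    list L refl = double-count δ≤ L

  -- Induction on `p`. When `p` is zero, `y`, `z` and `K` already form a clique that is too large.
  -- Otherwise a vertex of excessive weight yields a wheel with smaller `p`; if there is none, the
  -- weight sum contradicts the density.
  no-wheel : ∀ p {k δ} → CliqueFree (suc (k + p)) G → (∀ v → δ ≤ degree v) →
    3 * (k + p) * N < (3 * (k + p) + 2) * δ + N → ¬ Wheel k p
  no-wheel zero {k} free δ≤ dense W =
    <⇒≱ (s≤s (s≤s (≤-reflexive (trans (+-identityʳ k) (sym ∣K∣)))))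
      (free (y ∷ z ∷ K) ((y~z ∷ yK) ∷ zK ∷ K-clique))
    where open Wheel W
  no-wheel (suc p) {k} {δ} free δ≤ dense W with any? (λ w → Wheel.weight W w >? 3 * k + 3 * p + 2)
  ... | yes (w , heavy) with weight≤⊎extend W free w
  ...   | inj₁ light = <⇒≱ heavy light
  ...   | inj₂ W′ rewrite +-suc k p = no-wheel p free δ≤ dense W′
  no-wheel (suc p) {k} {δ} free δ≤ dense W | no ¬heavy = <⇒≱ dense (begin
    (3 * (k + suc p) + 2) * δ + N       ≤⟨ +-monoˡ-≤ N (weight-sum W δ≤) ⟩
    sum (Wheel.weight W) + N            ≤⟨ +-monoˡ-≤ N (sum-mono λ w → ≮⇒≥ λ h → ¬heavy (w , h)) ⟩
    sum {N} (λ _ → 3 * k + 3 * p + 2) + N  ≡⟨ cong (_+ N) (sum-const N _) ⟩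
    N * (3 * k + 3 * p + 2) + N         ≡⟨ identity N k p ⟩
    3 * (k + suc p) * N                 ∎)
    where
    open ≤-Reasoning
    identity : ∀ N k p → N * (3 * k + 3 * p + 2) + N ≡ 3 * (k + suc p) * N
    identity = solve-∀

-- Cliques as lists, and saturation

AllPairs-∈ : ∀ {A : Set} {R : A → A → Set} → (∀ {u v} → R u v → R v u) →
  ∀ {L u v} → AllPairs R L → u ∈ L → v ∈ L → u ≢ v → R u v
AllPairs-∈ R-sym (_ ∷ _)  (here refl) (here refl) u≢v = contradiction refl u≢v
AllPairs-∈ R-sym (r ∷ _)  (here refl) (there v∈L) u≢v = All.lookup r v∈L
AllPairs-∈ R-sym (r ∷ _)  (there u∈L) (here refl) u≢v = R-sym (All.lookup r u∈L)
AllPairs-∈ R-sym (_ ∷ rs) (there u∈L) (there v∈L) u≢v = AllPairs-∈ R-sym rs u∈L v∈L u≢v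

AllPairs-map-∈ : ∀ {A : Set} {R S : A → A → Set} {L : List A} →
  (∀ {u v} → u ∈ L → v ∈ L → R u v → S u v) → AllPairs R L → AllPairs S L
AllPairs-map-∈ f []       = []
AllPairs-map-∈ f (r ∷ rs) = All.tabulate (λ v∈L → f (here refl) (there v∈L) (All.lookup r v∈L)) ∷
  AllPairs-map-∈ (λ u∈L v∈L → f (there u∈L) (there v∈L)) rs

lookup-AllPairs : ∀ {A : Set} {R : A → A → Set} → (∀ {u v} → R u v → R v u) →
  ∀ {L} → AllPairs R L → ∀ i j → i ≢ j → R (lookup L i) (lookup L j)
lookup-AllPairs R-sym (r ∷ rs) zero    zero    i≢j = contradiction refl i≢j
lookup-AllPairs R-sym (r ∷ rs) zero    (suc j) i≢j = All.lookup r (∈-lookup j)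
lookup-AllPairs R-sym (r ∷ rs) (suc i) zero    i≢j = R-sym (All.lookup r (∈-lookup i))
lookup-AllPairs R-sym (r ∷ rs) (suc i) (suc j) i≢j =
  lookup-AllPairs R-sym rs i j (i≢j ∘ cong suc)

¬Clique⇒CliqueFree : ∀ {N t} (G : SimpleGraph N) → ¬ Clique (suc t) G → CliqueFree t G
¬Clique⇒CliqueFree G ¬clique L L-clique = ≮⇒≥ λ t<∣L∣ → ¬clique
  ( (λ i → lookup L (Fin.inject≤ i t<∣L∣))
  , λ i j i≢j → lookup-AllPairs (SimpleGraph.sym G) L-clique _ _
      (i≢j ∘ Fin.inject≤-injective t<∣L∣ t<∣L∣ i j))

module _ {N : ℕ} where

  open DecMembership {A = Fin N} Fin._≟_ using (_∈?_)

  infix 4 _⊑_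

  _⊑_ : SimpleGraph N → SimpleGraph N → Set
  G ⊑ G′ = ∀ {u v} → SimpleGraph._~_ G u v → SimpleGraph._~_ G′ u v

  ⊑-degree : ∀ {G G′} → G ⊑ G′ → ∀ v → SimpleGraph.degree G v ≤ SimpleGraph.degree G′ v
  ⊑-degree {G} {G′} G⊑G′ v = subst₂ _≤_
    (sym (size-tabulate {N} λ w → does (SimpleGraph._~?_ G v w)))
    (sym (size-tabulate {N} λ w → does (SimpleGraph._~?_ G′ v w)))
    (sum-mono λ w → step (SimpleGraph._~?_ G v w))
    where
    step : ∀ {w} (e : Dec (SimpleGraph._~_ G v w)) → ⟦ does e ⟧ ≤ ⟦ does (SimpleGraph._~?_ G′ v w) ⟧
    step (no _)  = z≤n
    step (yes e) = ≤-reflexive (sym (⟦yes⟧ (SimpleGraph._~?_ G′ v _) (G⊑G′ e)))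

  -- A K_q inside the common neighbourhood of x and y, that is, a K_{q+2} minus
  -- the edge xy.
  Blocked : ℕ → SimpleGraph N → Fin N → Fin N → Set
  Blocked q G x y = ∃[ Q ] length Q ≡ q × AllPairs _~_ Q × All (λ u → x ~ u × y ~ u) Q
    where open SimpleGraph G

  ⊑-Blocked : ∀ {q G G′ x y} → G ⊑ G′ → Blocked q G x y → Blocked q G′ x y
  ⊑-Blocked G⊑G′ (Q , ∣Q∣ , Q-clique , xyQ) =
    Q , ∣Q∣ , AllPairs.map G⊑G′ Q-clique , All.map (λ (a , b) → G⊑G′ a , G⊑G′ b) xyQ

  clique-in? : ∀ G k {P : Fin N → Set} → Decidable P →
    Dec (∃[ L ] length L ≡ k × AllPairs (SimpleGraph._~_ G) L × All P L)
  clique-in? G zero    P? = yes ([] , refl , [] , [])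
  clique-in? G (suc k) P? = map′
    (λ { (v , Pv , L , ∣L∣ , L-clique , all) →
         v ∷ L , cong suc ∣L∣ , All.map proj₂ all ∷ L-clique , Pv ∷ All.map proj₁ all })
    (λ { (v ∷ L , ∣L∣ , vL ∷ L-clique , Pv ∷ PL) →
         v , Pv , L , suc-injective ∣L∣ , L-clique , All.zip (PL , vL) })
    (any? λ v → P? v ×-dec clique-in? G k (λ u → P? u ×-dec SimpleGraph._~?_ G v u))

  blocked? : ∀ q G x y → Dec (Blocked q G x y)
  blocked? q G x y = clique-in? G q (λ u → (x ~? u) ×-dec (y ~? u))
    where open SimpleGraph G using (_~?_)

  addEdge : ∀ G {x y} → x ≢ y → SimpleGraph N
  addEdge G {x} {y} x≢y = record
    { _~_ = λ u v → u ~ v ⊎ (u ≡ x × v ≡ y ⊎ u ≡ y × v ≡ x)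
    ; sym = λ { (inj₁ e) → inj₁ (SimpleGraph.sym G e)
              ; (inj₂ (inj₁ (p , q))) → inj₂ (inj₂ (q , p))
              ; (inj₂ (inj₂ (p , q))) → inj₂ (inj₁ (q , p)) }
    ; irrefl = λ { refl (inj₁ e) → SimpleGraph.irrefl G refl e
                 ; refl (inj₂ (inj₁ (p , q))) → x≢y (trans (sym p) q)
                 ; refl (inj₂ (inj₂ (p , q))) → x≢y (trans (sym q) p) }
    ; _~?_ = λ u v → (u ~? v) ⊎-dec (((u Fin.≟ x) ×-dec (v Fin.≟ y)) ⊎-dec ((u Fin.≟ y) ×-dec (v Fin.≟ x)))
    }
    where open SimpleGraph G using (_~_; _~?_)

  remove : Fin N → List (Fin N) → List (Fin N)
  remove x = filter (λ u → ¬? (u Fin.≟ x))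

  length-remove : ∀ {L} x → AllPairs _≢_ L → length L ≤ suc (length (remove x L))
  length-remove x [] = z≤n
  length-remove {u ∷ L} x (u≢L ∷ L!) with u Fin.≟ x
  ... | yes refl = s≤s (≤-reflexive (cong length (sym
          (List.filter-all (λ v → ¬? (v Fin.≟ x)) (All.map (λ u≢v → u≢v ∘ sym) u≢L)))))
  ... | no _     = s≤s (length-remove x L!)

  -- A clique on more than q + 1 vertices must use the new edge, so it contains both `x` and `y`.
  -- Its other vertices, at least q of them, are common neighbours of `x` and `y` in `G` and block
  -- the pair.
  addEdge-CliqueFree : ∀ {q G x y} (x≢y : x ≢ y) → CliqueFree (suc q) G →
    ¬ Blocked q G x y → CliqueFree (suc q) (addEdge G x≢y)
  addEdge-CliqueFree {q} {G} {x} {y} x≢y free ¬blocked L L-clique = ≮⇒≥ λ q<∣L∣ → ¬blocked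
    ( take q Q
    , trans (List.length-take q Q) (m≤n⇒m⊓n≡m (s≤s⁻¹ (s≤s⁻¹ (begin
        suc (suc q)                    ≤⟨ q<∣L∣ ⟩
        length L                       ≤⟨ length-remove x L! ⟩
        suc (length (remove x L))      ≤⟨ s≤s (length-remove y (AllPairs.filter⁺ _ L!)) ⟩
        suc (suc (length Q))           ∎))))
    , AllPairs.take⁺ q (AllPairs-map-∈
        (λ u∈Q v∈Q → old (u≢x u∈Q) (u≢y u∈Q))
        (AllPairs.filter⁺ _ (AllPairs.filter⁺ _ L-clique)))
    , All.take⁺ q (All.tabulate λ u∈Q →
        ( adj (u≢x u∈Q) (u≢y u∈Q) (AllPairs-∈ G⁺.sym L-clique (x∈L q<∣L∣) (u∈L u∈Q) (u≢x u∈Q ∘ sym))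
        , adj (u≢x u∈Q) (u≢y u∈Q) (AllPairs-∈ G⁺.sym L-clique (y∈L q<∣L∣) (u∈L u∈Q) (u≢y u∈Q ∘ sym)))))
    where
    open ≤-Reasoning
    open SimpleGraph G using (_~_)
    module G⁺ = SimpleGraph (addEdge G x≢y)
    Q = remove y (remove x L)
    L! : AllPairs _≢_ L
    L! = AllPairs.map (λ e u≡v → G⁺.irrefl u≡v e) L-clique
    u∈L : ∀ {u} → u ∈ Q → u ∈ L
    u∈L u∈Q = proj₁ (∈-filter⁻ _ (proj₁ (∈-filter⁻ _ u∈Q)))
    u≢x : ∀ {u} → u ∈ Q → u ≢ x
    u≢x u∈Q = proj₂ (∈-filter⁻ _ {xs = L} (proj₁ (∈-filter⁻ _ u∈Q)))
    u≢y : ∀ {u} → u ∈ Q → u ≢ y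
    u≢y u∈Q = proj₂ (∈-filter⁻ _ {xs = remove x L} u∈Q)
    old : ∀ {u v} → u ≢ x → u ≢ y → u G⁺.~ v → u ~ v
    old u≢x u≢y (inj₁ e) = e
    old u≢x u≢y (inj₂ (inj₁ (p , _))) = contradiction p u≢x
    old u≢x u≢y (inj₂ (inj₂ (p , _))) = contradiction p u≢y
    adj : ∀ {u v} → u ≢ x → u ≢ y → v G⁺.~ u → v ~ u
    adj u≢x u≢y e = SimpleGraph.sym G (old u≢x u≢y (G⁺.sym e))
    x∈L : suc q < length L → x ∈ L
    x∈L q<∣L∣ with x ∈? L
    ... | yes x∈ = x∈
    ... | no x∉ = contradiction (free L (AllPairs-map-∈
            (λ { u∈ v∈ (inj₁ e) → e
               ; u∈ v∈ (inj₂ (inj₁ (refl , _))) → contradiction u∈ x∉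
               ; u∈ v∈ (inj₂ (inj₂ (_ , refl))) → contradiction v∈ x∉ }) L-clique))
            (<⇒≱ q<∣L∣)
    y∈L : suc q < length L → y ∈ L
    y∈L q<∣L∣ with y ∈? L
    ... | yes y∈ = y∈
    ... | no y∉ = contradiction (free L (AllPairs-map-∈
            (λ { u∈ v∈ (inj₁ e) → e
               ; u∈ v∈ (inj₂ (inj₁ (_ , refl))) → contradiction v∈ y∉
               ; u∈ v∈ (inj₂ (inj₂ (refl , _))) → contradiction u∈ y∉ }) L-clique))
            (<⇒≱ q<∣L∣)

  Saturated : ℕ → SimpleGraph N → Fin N × Fin N → Set
  Saturated q G (x , y) = x ≡ y ⊎ x ~ y ⊎ Blocked q G x y
    where open SimpleGraph G

  ⊑-Saturated : ∀ {q G G′ e} → G ⊑ G′ → Saturated q G e → Saturated q G′ e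
  ⊑-Saturated G⊑G′ (inj₁ x≡y)        = inj₁ x≡y
  ⊑-Saturated G⊑G′ (inj₂ (inj₁ x~y)) = inj₂ (inj₁ (G⊑G′ x~y))
  ⊑-Saturated {q} {G} {G′} G⊑G′ (inj₂ (inj₂ b)) = inj₂ (inj₂ (⊑-Blocked {G = G} {G′} G⊑G′ b))

  saturate-pair : ∀ q G → CliqueFree (suc q) G → ∀ e →
    ∃[ G′ ] G ⊑ G′ × CliqueFree (suc q) G′ × Saturated q G′ e
  saturate-pair q G free (x , y) with x Fin.≟ y
  ... | yes x≡y = G , (λ e → e) , free , inj₁ x≡y
  ... | no x≢y with blocked? q G x y
  ...   | yes b = G , (λ e → e) , free , inj₂ (inj₂ b)
  ...   | no ¬b = addEdge G x≢y , inj₁ , addEdge-CliqueFree {G = G} x≢y free ¬b ,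
                  inj₂ (inj₁ (inj₂ (inj₁ (refl , refl))))

  -- A single pass over the pairs is enough, because a pair once saturated stays saturated when
  -- further edges are added.
  saturate-pairs : ∀ q G → CliqueFree (suc q) G → ∀ E →
    ∃[ G′ ] G ⊑ G′ × CliqueFree (suc q) G′ × All (Saturated q G′) E
  saturate-pairs q G free []      = G , (λ e → e) , free , []
  saturate-pairs q G free (e ∷ E) =
    let G₁ , G⊑G₁ , free₁ , sat₁ = saturate-pair q G free e
        G₂ , G₁⊑G₂ , free₂ , sat₂ = saturate-pairs q G₁ free₁ E
    in G₂ , (λ e → G₁⊑G₂ (G⊑G₁ e)) , free₂ , ⊑-Saturated {G = G₁} {G₂} G₁⊑G₂ sat₁ ∷ sat₂

  saturate : ∀ q G → CliqueFree (suc q) G →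
    ∃[ G′ ] G ⊑ G′ × CliqueFree (suc q) G′ × (∀ x y → Saturated q G′ (x , y))
  saturate q G free =
    let G′ , G⊑G′ , free′ , sat = saturate-pairs q G free (cartesianProduct (allFin N) (allFin N))
    in G′ , G⊑G′ , free′ , λ x y → All.lookup sat (∈-cartesianProduct⁺ (∈-allFin x) (∈-allFin y))

-- Colouring dense clique-free graphs

Colouring : ∀ {N} → ℕ → SimpleGraph N → Set
Colouring {N} t G = Σ[ c ∈ (Fin N → Fin t) ] (∀ {u v} → c u ≡ c v → ¬ (u ~ v))
  where open SimpleGraph G

module _ {N} (G : SimpleGraph N) where
  open SimpleGraph G renaming (sym to ~-sym)

  -- Greedy choice: a vertex adjacent to all of `L` is added to `L`. It then dominates itself, by
  -- irreflexivity.
  dominating-clique : ∀ V → ∃[ L ] AllPairs _~_ L × All (λ v → Any (λ u → ¬ u ~ v) L) V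
  dominating-clique [] = [] , [] , []
  dominating-clique (v ∷ V) with dominating-clique V
  ... | L , L-clique , dominates with Any.any? (λ u → ¬? (u ~? v)) L
  ...   | yes dominated = L , L-clique , dominated ∷ dominates
  ...   | no ¬dominated = v ∷ L
          , All.map (λ {u} ¬¬e → ~-sym (decidable-stable (u ~? v) ¬¬e)) (All.¬Any⇒All¬ L ¬dominated) ∷ L-clique
          , here (irrefl refl) ∷ All.map there dominates

  -- The colour of a vertex is the index of a clique member not adjacent to it. Two vertices with
  -- the same such member are non-adjacent by transitivity.
  multipartite-colouring : ∀ {t} → CliqueFree t G →
    (∀ {x y z} → ¬ x ~ y → ¬ x ~ z → ¬ y ~ z) → Colouring t G
  multipartite-colouring free ≁-trans =
    let L , L-clique , dominates = dominating-clique (allFin N)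
        index = λ v → Any.index (All.lookup dominates (∈-allFin v))
        nonadjacent = λ v → Any.lookup-index (All.lookup dominates (∈-allFin v))
        ∣L∣≤t = free L L-clique
    in (λ v → Fin.inject≤ (index v) ∣L∣≤t)
     , λ {u} {v} same → ≁-trans (nonadjacent u)
         (subst (λ i → ¬ lookup L i ~ v) (sym (Fin.inject≤-injective ∣L∣≤t ∣L∣≤t _ _ same)) (nonadjacent v))

-- The hypothesis is δ > (3t − 4) N / (3t − 1) for t = q + 1, without subtraction.
dense⇒colourable : ∀ {N} q (G : SimpleGraph N) {δ} → CliqueFree (suc q) G →
  (∀ v → δ ≤ SimpleGraph.degree G v) → 3 * q * N < (3 * q + 2) * δ + N →
  Colouring (suc q) G
dense⇒colourable {N} q G {δ} free δ≤ dense =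
  let G′ , G⊑G′ , free′ , saturated = saturate q G free
      c , proper = multipartite-colouring G′ free′ (≁-trans G′ G⊑G′ free′ saturated)
  in c , λ same e → proper same (G⊑G′ e)
  where
  ≁-trans : ∀ G′ → G ⊑ G′ → CliqueFree (suc q) G′ → (∀ x y → Saturated q G′ (x , y)) →
    let _~_ = SimpleGraph._~_ G′ in ∀ {x y z} → ¬ (x ~ y) → ¬ (x ~ z) → ¬ (y ~ z)
  ≁-trans G′ G⊑G′ free′ saturated {x} {y} {z} x≁y x≁z y~z with saturated x y | saturated x z
  ... | inj₁ refl | _ = x≁z y~z
  ... | inj₂ (inj₁ x~y) | _ = x≁y x~y
  ... | inj₂ (inj₂ _) | inj₁ refl = x≁y (SimpleGraph.sym G′ y~z)
  ... | inj₂ (inj₂ _) | inj₂ (inj₁ x~z) = x≁z x~z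
  ... | inj₂ (inj₂ (Q , ∣Q∣ , Q-clique , xyQ)) | inj₂ (inj₂ (R , ∣R∣ , R-clique , xzR)) =
    -- The cliques blocking xy and xz serve as `Q` and `R`, and the common part `K` starts empty.
    no-wheel q free′ (λ v → ≤-trans (δ≤ v) (⊑-degree {G = G} {G′} G⊑G′ v)) dense record
      { K = [] ; x≁y = x≁y ; x≁z = x≁z ; y~z = y~z
      ; ∣K∣ = refl ; ∣Q∣ = ∣Q∣ ; ∣R∣ = ∣R∣
      ; K-clique = [] ; Q-clique = Q-clique ; R-clique = R-clique
      ; KQ = [] ; KR = [] ; xK = [] ; yK = [] ; zK = []
      ; xQ = All.map proj₁ xyQ ; yQ = All.map proj₂ xyQ
      ; xR = All.map proj₁ xzR ; zR = All.map proj₂ xzR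
      }
    where open Adjacency G′

-- Upper bound

third : ∀ {t} (A B : Fin (3 + t)) → ∃[ C ] A ≢ C × B ≢ C
third zero          zero          = suc zero , (λ ()) , (λ ())
third zero          (suc zero)    = suc (suc zero) , (λ ()) , (λ ())
third zero          (suc (suc _)) = suc zero , (λ ()) , (λ ())
third (suc zero)    zero          = suc (suc zero) , (λ ()) , (λ ())
third (suc (suc _)) zero          = suc zero , (λ ()) , (λ ())
third (suc _)       (suc _)       = zero , (λ ()) , (λ ())

-- For D = (m − 1) s + T, the condition "H > 0, or H = 0 and (n − s) ∣ T", in
-- terms of m′ = m − 1.
Good : (n m′ t r s T : ℕ) → Set
Good n m′ t r s T = let D = m′ * s + T in
  r * n + 2 * s < n + t * (D + s) ⊎
  (r * n + 2 * s ≡ n + t * (D + s) × (n ∸ s) ∣ T)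

-- The entry `x i j` is the number of vertices of part i with colour j. From here the argument
-- concerns only a matrix of natural numbers; D is split into quotient `s` and remainder `T` modulo
-- `m′`.
module Matrix
  {r t′ n m′ s T : ℕ}
  (x : Fin r → Fin (3 + t′) → ℕ)
  (row≡n : ∀ i → sum (x i) ≡ n)
  (column≤ : ∀ {i j} → 0 < x i j → sum (λ i → x i j) ≤ m′ * s + T + x i j)
  (T<m′ : T < m′) (many-rows : (3 + t′) * m′ < r) (D< : m′ * s + T < m′ * n)
  where

  t D M : ℕ
  t = 3 + t′
  D = m′ * s + T
  M = D + s

  column : Fin t → ℕ
  column j = sum (λ i → x i j)

  x≤n : ∀ i j → x i j ≤ n
  x≤n i j = ≤-trans (term≤sum (x i) j) (≤-reflexive (row≡n i))

  total : sum column ≡ r * n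
  total = trans (∑-comm (λ j i → x i j)) (trans (sum-cong-≗ row≡n) (sum-const r n))

  positive : Fin t → Fin r → ℕ
  positive j i = ⟦ does (0 <? x i j) ⟧

  *positive≡ : ∀ {i j} y → 0 < x i j → y * positive j i ≡ y
  *positive≡ {i} {j} y 0<x = trans (cong (y *_) (⟦yes⟧ (0 <? x i j) 0<x)) (*-identityʳ y)

  *¬positive≡0 : ∀ {i j} y → ¬ 0 < x i j → y * positive j i ≡ 0
  *¬positive≡0 {i} {j} y ¬0<x = trans (cong (y *_) (⟦no⟧ (0 <? x i j) ¬0<x)) (*-zeroʳ y)

  support : Fin t → ℕ
  support j = sum (positive j)

  column≤n*support : ∀ j → column j ≤ n * support j
  column≤n*support j = ≤-trans (sum-mono entry) (≤-reflexive (sym (*-distribˡ-sum n (positive j))))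
    where
    entry : ∀ i → x i j ≤ n * positive j i
    entry i with x i j in eq
    ... | zero  = z≤n
    ... | suc _ = ≤-trans (≤-reflexive (sym eq)) (≤-trans (x≤n i j) (≤-reflexive (sym (*-identityʳ n))))

  *support≤column : ∀ {y j} → (∀ i → 0 < x i j → y ≤ x i j) → y * support j ≤ column j
  *support≤column {y} {j} y≤ = ≤-trans (≤-reflexive (*-distribˡ-sum y (positive j))) (sum-mono entry)
    where
    entry : ∀ i → y * positive j i ≤ x i j
    entry i with 0 <? x i j
    ... | yes 0<x = ≤-trans (≤-reflexive (*positive≡ y 0<x)) (y≤ i 0<x)
    ... | no ¬0<x = ≤-trans (≤-reflexive (*¬positive≡0 y ¬0<x)) z≤n

  Large : Fin t → Set
  Large j = m′ * n < column j

  large⇒support : ∀ {j} → Large j → m′ < support j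
  large⇒support {j} large = *-cancelʳ-< n m′ (support j)
    (<-≤-trans large (≤-trans (column≤n*support j) (≤-reflexive (*-comm n (support j)))))

  -- Every positive entry of the column is at least y, the excess of the column over D, and a large
  -- column has at least m′ + 1 positive entries. So y > s would make the column too long.
  large⇒≤M : ∀ {j} → Large j → column j ≤ M
  large⇒≤M {j} large = ≮⇒≥ λ M<column →
    let y = column j ∸ D
        y+D≡column : y + D ≡ column j
        y+D≡column = m∸n+n≡m (≤-trans (m≤m+n D s) (<⇒≤ M<column))
        s<y : s < y
        s<y = +-cancelʳ-< D s y (<-≤-trans (≤-trans (s≤s (≤-reflexive (+-comm s D))) M<column)
                (≤-reflexive (sym y+D≡column)))
        y*support≤ : y * support j ≤ y + D
        y*support≤ = ≤-trans
          (*support≤column λ i 0<x → m≤n+o⇒m∸n≤o (column j) D (column≤ 0<x))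
          (≤-reflexive (sym y+D≡column))
        -- m′ (s + 1) ≤ m′ y ≤ D = m′ s + T
        m′≤T : m′ ≤ T
        m′≤T = linear 0
          ((m′ ⊛ s<y) ⊕ (y ⊛ large⇒support large) ⊕ y*support≤)
          (identity m′ s T y (support j))
    in <⇒≱ T<m′ m′≤T
    where
    identity : ∀ m s T y k → m + (m * y + (y * k + (y + (m * s + T)))) + 0
      ≡ T + (m * suc s + (y * suc m + y * k))
    identity = solve-∀

  -- Averaging: t columns of at most m′ n each cannot hold r n, since t m′ < r.
  ∃-large : ∃ Large
  ∃-large with any? (λ j → m′ * n <? column j)
  ... | yes large = large
  ... | no ¬large = contradiction (begin-strict
          r * n                         ≡⟨ total ⟨
          sum column                    ≤⟨ sum-mono (λ j → ≮⇒≥ λ large → ¬large (j , large)) ⟩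
          sum {t} (λ _ → m′ * n)        ≡⟨ sum-const t (m′ * n) ⟩
          t * (m′ * n)                  ≡⟨ *-assoc t m′ n ⟨
          t * m′ * n                    <⟨ *-monoˡ-< n {{n≢0}} many-rows ⟩
          r * n                         ∎) (n≮n _)
    where
    open ≤-Reasoning
    n≢0 : NonZero n
    n≢0 = ≢-nonZero λ { refl → <⇒≱ D< (≤-trans (≤-reflexive (*-zeroʳ m′)) z≤n) }

  column≤M : ∀ j → column j ≤ M
  column≤M j with m′ * n <? column j
  ... | yes large = large⇒≤M large
  ... | no ¬large = let _ , large = ∃-large in
        ≤-trans (≮⇒≥ ¬large) (≤-trans (<⇒≤ large) (large⇒≤M large))

  -- If every positive entry were n, the column would be at least (m′ + 1) n and at most D + n,
  -- against D < m′ n.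
  ∃-fractional : ∀ {j} → Large j → ∃[ i ] 0 < x i j × x i j < n
  ∃-fractional {j} large with any? (λ i → (0 <? x i j) ×-dec (x i j <? n))
  ... | yes fractional = fractional
  ... | no ¬fractional = contradiction D< (≤⇒≯ m′n≤D)
    where
    full : ∀ i → 0 < x i j → n ≤ x i j
    full i 0<x = ≮⇒≥ λ x<n → ¬fractional (i , 0<x , x<n)
    ∃-positive : ∃[ i ] 0 < x i j
    ∃-positive with any? (λ i → 0 <? x i j)
    ... | yes p = p
    ... | no ¬p = contradiction
            (sum-zero λ i → n≤0⇒n≡0 (≮⇒≥ λ 0<x → ¬p (i , 0<x)))
            (m<n⇒n≢0 large)
    m′n≤D : m′ * n ≤ D
    m′n≤D = let i , 0<x = ∃-positive in linear 0
      ((n ⊛ large⇒support large) ⊕ *support≤column full ⊕ column≤ 0<x ⊕ x≤n i j)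
      (identity m′ n D (support j) (column j) (x i j))
      where
      identity : ∀ m n D k c x → m * n + (n * k + (c + (D + x + n))) + 0
        ≡ D + (n * suc m + (n * k + (c + x)))
      identity = solve-∀

  ∃-sharing : ∀ {i j} → x i j < n → ∃[ j′ ] j ≢ j′ × 0 < x i j′
  ∃-sharing {i} {j} x<n with any? (λ j′ → ¬? (j Fin.≟ j′) ×-dec (0 <? x i j′))
  ... | yes sharing = sharing
  ... | no ¬sharing = contradiction x<n (≤⇒≯ (begin
          n                                            ≡⟨ row≡n i ⟨
          sum (x i)                                    ≤⟨ sum-mono entry ⟩
          sum (λ j′ → ⟦ does (j Fin.≟ j′) ⟧ * x i j)   ≡⟨ sum-indicator′ j (λ _ → x i j) ⟩
          x i j                                        ∎))
    where
    open ≤-Reasoning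
    entry : ∀ j′ → x i j′ ≤ ⟦ does (j Fin.≟ j′) ⟧ * x i j
    entry j′ with j Fin.≟ j′
    ... | yes refl = ≤-reflexive (sym (+-identityʳ _))
    ... | no j≢j′  = ≮⇒≥ λ 0<x → ¬sharing (j′ , j≢j′ , 0<x)

  -- Add the two column conditions at row i, where the two entries sum to at most n.
  sharing-bound : ∀ {i A B} → A ≢ B → 0 < x i A → 0 < x i B →
    column A + column B ≤ 2 * D + n
  sharing-bound {i} {A} {B} A≢B 0<xA 0<xB = linear 0
    (column≤ 0<xA ⊕ column≤ 0<xB ⊕ ≤-trans (two-terms≤sum (x i) A≢B) (≤-reflexive (row≡n i)))
    (identity (column A) (column B) D n (x i A) (x i B))
    where
    identity : ∀ a b D n xa xb → a + b + (D + xa + (D + xb + n)) + 0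
      ≡ 2 * D + n + (a + (b + (xa + xb)))
    identity = solve-∀

  gap : Fin t → ℕ
  gap j = M ∸ column j

  gap+column : ∀ j → gap j + column j ≡ M
  gap+column j = m∸n+n≡m (column≤M j)

  gap-total : sum gap + r * n ≡ t * M
  gap-total = begin
    sum gap + r * n                ≡⟨ cong (sum gap +_) total ⟨
    sum gap + sum column           ≡⟨ ∑-distrib-+ gap column ⟨
    sum (λ j → gap j + column j)   ≡⟨ sum-cong-≗ gap+column ⟩
    sum {t} (λ _ → M)              ≡⟨ sum-const t M ⟩
    t * M                          ∎
    where open ≡-Reasoning

  sharing-gap : ∀ {i A B} → A ≢ B → 0 < x i A → 0 < x i B → 2 * s ≤ n + (gap A + gap B)
  sharing-gap {i} {A} {B} A≢B 0<xA 0<xB = linear 0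
    (sharing-bound A≢B 0<xA 0<xB ⊕ ≤-reflexive (sym (gap+column A)) ⊕ ≤-reflexive (sym (gap+column B)))
    (identity s n D (gap A) (gap B) (column A) (column B))
    where
    identity : ∀ s n D ga gb ca cb → 2 * s + (2 * D + n + (ga + ca + (gb + cb))) + 0
      ≡ n + (ga + gb) + (ca + cb + (D + s + (D + s)))
    identity = solve-∀

  -- As the gaps sum to t M - r n, this is H ≥ 0 with D in place of d.
  2s≤n+Σgap : 2 * s ≤ n + sum gap
  2s≤n+Σgap =
    let A , large = ∃-large
        i , 0<xA , xA<n = ∃-fractional large
        B , A≢B , 0<xB = ∃-sharing xA<n
    in ≤-trans (sharing-gap A≢B 0<xA 0<xB) (+-monoʳ-≤ n (two-terms≤sum gap A≢B))

  module Tight (tight : r * n + 2 * s ≡ n + t * M) where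

    n+Σgap≡2s : n + sum gap ≡ 2 * s
    n+Σgap≡2s = +-cancelˡ-≡ (r * n) _ _ (begin
      r * n + (n + sum gap)  ≡⟨ identity (r * n) n (sum gap) ⟩
      n + (sum gap + r * n)  ≡⟨ cong (n +_) gap-total ⟩
      n + t * M              ≡⟨ tight ⟨
      r * n + 2 * s          ∎)
      where
      open ≡-Reasoning
      identity : ∀ a b c → a + (b + c) ≡ b + (c + a)
      identity = solve-∀

    -- Under tightness the gaps of two classes sharing a part already exhaust the total gap 2s - n,
    -- so any third class has none.
    ∃-gapless : ∃[ C ] gap C ≡ 0
    ∃-gapless =
      let A , large = ∃-large
          i , 0<xA , xA<n = ∃-fractional large
          B , A≢B , 0<xB = ∃-sharing xA<n
          C , A≢C , B≢C = third A B
      in C , n≤0⇒n≡0 (linear 0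
        (three-terms≤sum gap A≢B A≢C B≢C ⊕ sharing-gap A≢B 0<xA 0<xB ⊕ ≤-reflexive n+Σgap≡2s)
        (identity (gap A) (gap B) (gap C) (sum gap) s n))
      where
      identity : ∀ a b c S s n → c + (S + (n + (a + b) + 2 * s)) + 0
        ≡ 0 + (a + b + c + (2 * s + (n + S)))
      identity = solve-∀

    C = proj₁ ∃-gapless

    gapC≡0 : gap C ≡ 0
    gapC≡0 = proj₂ ∃-gapless

    columnC : column C ≡ M
    columnC = trans (cong (_+ column C) (sym gapC≡0)) (gap+column C)

    largeC : Large C
    largeC = let A , large = ∃-large in
      <-≤-trans large (≤-trans (column≤M A) (≤-reflexive (sym columnC)))

    -- The column condition for C, whose sum is D + s, gives x ≥ s. Some other class B meets the
    -- row; its gap is at most 2s - n, so its entry is at least n - s, which leaves at most s for C.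
    fractional≡s : ∀ {i} → 0 < x i C → x i C < n → x i C ≡ s
    fractional≡s {i} 0<xC xC<n = ≤-antisym upper lower
      where
      lower : s ≤ x i C
      lower = +-cancelˡ-≤ D _ _ (≤-trans (≤-reflexive (sym columnC)) (column≤ 0<xC))
      upper : x i C ≤ s
      upper =
        let B , C≢B , 0<xB = ∃-sharing xC<n
        in linear 0
          (≤-trans (two-terms≤sum (x i) C≢B) (≤-reflexive (row≡n i)) ⊕
           column≤ 0<xB ⊕ ≤-reflexive (sym (gap+column B)) ⊕
           term≤sum gap B ⊕ ≤-reflexive n+Σgap≡2s)
          (identity (x i C) (x i B) D s n (gap B) (column B) (sum gap))
        where
        identity : ∀ xc xb D s n g c S →
          xc + (n + (D + xb + (g + c + (S + 2 * s)))) + 0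
          ≡ s + (xc + xb + (c + (D + s + (g + (n + S)))))
        identity = solve-∀

    g = n ∸ s

    s<n : s < n
    s<n = *-cancelˡ-< m′ s n (≤-<-trans (m≤m+n (m′ * s) T) D<)

    s+g≡n : s + g ≡ n
    s+g≡n = m+[n∸m]≡n (<⇒≤ s<n)

    full : Fin r → ℕ
    full i = ⟦ does (n ≤? x i C) ⟧

    *full≡g : ∀ {i} → n ≤ x i C → g * full i ≡ g
    *full≡g {i} n≤x = trans (cong (g *_) (⟦yes⟧ (n ≤? x i C) n≤x)) (*-identityʳ g)

    *¬full≡0 : ∀ {i} → ¬ n ≤ x i C → g * full i ≡ 0
    *¬full≡0 {i} n≰x = trans (cong (g *_) (⟦no⟧ (n ≤? x i C) n≰x)) (*-zeroʳ g)

    entryC : ∀ i → x i C ≡ s * positive C i + g * full i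
    entryC i = cases (0 <? x i C) (n ≤? x i C)
      where
      cases : Dec (0 < x i C) → Dec (n ≤ x i C) → x i C ≡ s * positive C i + g * full i
      cases (no ¬0<x) (yes n≤x) = contradiction (<-≤-trans (≤-<-trans z≤n s<n) n≤x) ¬0<x
      cases (no ¬0<x) (no n≰x)  = trans (n≤0⇒n≡0 (≮⇒≥ ¬0<x))
        (sym (cong₂ _+_ (*¬positive≡0 s ¬0<x) (*¬full≡0 n≰x)))
      cases (yes 0<x) (yes n≤x) = trans (≤-antisym (x≤n i C) n≤x)
        (trans (sym s+g≡n) (sym (cong₂ _+_ (*positive≡ s 0<x) (*full≡g n≤x))))
      cases (yes 0<x) (no n≰x)  = trans (fractional≡s 0<x (≰⇒> n≰x))
        (trans (sym (+-identityʳ s)) (sym (cong₂ _+_ (*positive≡ s 0<x) (*¬full≡0 n≰x))))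

    columnC-split : column C ≡ s * support C + g * sum full
    columnC-split = begin
      column C                                                       ≡⟨ sum-cong-≗ entryC ⟩
      sum (λ i → s * positive C i + g * full i)                      ≡⟨ ∑-distrib-+ _ (λ i → g * full i) ⟩
      sum (λ i → s * positive C i) + sum (λ i → g * full i)          ≡⟨ cong₂ _+_ (*-distribˡ-sum s (positive C)) (*-distribˡ-sum g full) ⟨
      s * support C + g * sum full                                   ∎
      where open ≡-Reasoning

    excess = support C ∸ suc m′

    -- Column C equals s (m′ + 1) + T and also consists of pieces s and n = s + g. Cancelling s (m′
    -- + 1) leaves the pieces beyond the first m′ + 1.
    T-split : T ≡ s * excess + g * sum full
    T-split = +-cancelˡ-≡ (s * suc m′) _ _ (begin
      s * suc m′ + T                              ≡⟨ identity m′ s T ⟩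
      D + s                                       ≡⟨ columnC ⟨
      column C                                    ≡⟨ columnC-split ⟩
      s * support C + g * sum full                ≡⟨ cong (λ k → s * k + g * sum full) (m+[n∸m]≡n (large⇒support largeC)) ⟨
      s * (suc m′ + excess) + g * sum full        ≡⟨ distrib s (suc m′) excess (g * sum full) ⟩
      s * suc m′ + (s * excess + g * sum full)    ∎)
      where
      open ≡-Reasoning
      identity : ∀ m s T → s * suc m + T ≡ m * s + T + s
      identity = solve-∀
      distrib : ∀ s a b c → s * (a + b) + c ≡ s * a + (s * b + c)
      distrib = solve-∀

    -- Largeness of C means m′ g < T + s, and T + s ≤ 2T < 2m′. This settles the case of a positive
    -- `excess`.
    s≤T⇒g≡1 : s ≤ T → g ≡ 1
    s≤T⇒g≡1 s≤T = ≤-antisym (s≤s⁻¹ (*-cancelˡ-< m′ g 2 m′g<m′2)) (m<n⇒0<n∸m s<n)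
      where
      m′g<m′2 : m′ * g < m′ * 2
      m′g<m′2 = linear 2
        (subst₂ _≤_ (cong (λ k → suc (m′ * k)) (sym s+g≡n)) columnC largeC ⊕ s≤T ⊕ (2 ⊛ T<m′))
        (identity m′ g s T)
        where
        identity : ∀ m g s T → suc (m * g) + (m * s + T + s + (T + 2 * m)) + 2
          ≡ m * 2 + (suc (m * (s + g)) + (s + 2 * suc T))
        identity = solve-∀

    g∣T : g ∣ T
    g∣T = cases excess T-split
      where
      cases : ∀ e → T ≡ s * e + g * sum full → g ∣ T
      cases zero    T≡ = divides (sum full) (trans T≡
        (trans (cong (_+ g * sum full) (*-zeroʳ s)) (*-comm g (sum full))))
      cases (suc e) T≡ = subst (_∣ T) (sym (s≤T⇒g≡1 s≤T)) (1∣ T)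
        where
        s≤T : s ≤ T
        s≤T = ≤-trans (≤-trans (m≤m*n s (suc e)) (m≤m+n _ _)) (≤-reflexive (sym T≡))

  good : Good n m′ t r s T
  good = cases (m≤n⇒m<n∨m≡n rn+2s≤)
    where
    rn+2s≤ : r * n + 2 * s ≤ n + t * M
    rn+2s≤ = linear 0 (2s≤n+Σgap ⊕ ≤-reflexive gap-total) (identity (r * n) s n (sum gap) (t * M))
      where
      identity : ∀ a s n S b → a + 2 * s + (n + S + b) + 0 ≡ n + b + (2 * s + (S + a))
      identity = solve-∀
    cases : r * n + 2 * s < n + t * M ⊎ r * n + 2 * s ≡ n + t * M → Good n m′ t r s T
    cases (inj₁ strict) = inj₁ strict
    cases (inj₂ tight)  = inj₂ (tight , Tight.g∣T tight)

-- From coloured partite graphs to matrices of cells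

fibre-total : ∀ {N r} (part : Fin N → Fin r) →
  sum (λ i → sum (λ v → ⟦ does (part v Fin.≟ i) ⟧)) ≡ N
fibre-total {N} part = begin
  sum (λ i → sum (λ v → ⟦ does (part v Fin.≟ i) ⟧))      ≡⟨ ∑-comm (λ i v → ⟦ does (part v Fin.≟ i) ⟧) ⟩
  sum (λ v → sum (λ i → ⟦ does (part v Fin.≟ i) ⟧))      ≡⟨ sum-cong-≗ (λ v → trans
    (sum-cong-≗ λ i → sym (*-identityʳ ⟦ does (part v Fin.≟ i) ⟧)) (sum-indicator′ (part v) (λ _ → 1))) ⟩
  sum {N} (λ _ → 1)                                      ≡⟨ sum-const N 1 ⟩
  N * 1                                                  ≡⟨ *-identityʳ N ⟩
  N                                                      ∎
  where open ≡-Reasoning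

module Cells {N r t : ℕ} (part : Fin N → Fin r) (colour : Fin N → Fin t) where

  cell : Fin r → Fin t → ℕ
  cell i j = sum (λ v → ⟦ does (part v Fin.≟ i) ⟧ * ⟦ does (colour v Fin.≟ j) ⟧)

  row-total : ∀ i → sum (cell i) ≡ sum (λ v → ⟦ does (part v Fin.≟ i) ⟧)
  row-total i = trans
    (∑-comm (λ j v → ⟦ does (part v Fin.≟ i) ⟧ * ⟦ does (colour v Fin.≟ j) ⟧))
    (sum-cong-≗ λ v → trans
      (sum-cong-≗ λ j → *-comm ⟦ does (part v Fin.≟ i) ⟧ ⟦ does (colour v Fin.≟ j) ⟧)
      (sum-indicator′ (colour v) (λ _ → ⟦ does (part v Fin.≟ i) ⟧)))

  column-total : ∀ j → sum (λ i → cell i j) ≡ sum (λ v → ⟦ does (colour v Fin.≟ j) ⟧)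
  column-total j = trans
    (∑-comm (λ i v → ⟦ does (part v Fin.≟ i) ⟧ * ⟦ does (colour v Fin.≟ j) ⟧))
    (sum-cong-≗ λ v → sum-indicator′ (part v) (λ _ → ⟦ does (colour v Fin.≟ j) ⟧))

  cell-inhabited : ∀ {i j} → 0 < cell i j → ∃[ v ] part v ≡ i × colour v ≡ j
  cell-inhabited {i} {j} 0<cell with any? (λ v → (part v Fin.≟ i) ×-dec (colour v Fin.≟ j))
  ... | yes inhabited = inhabited
  ... | no empty = contradiction (sum-zero entry) (m<n⇒n≢0 0<cell)
    where
    entry : ∀ v → ⟦ does (part v Fin.≟ i) ⟧ * ⟦ does (colour v Fin.≟ j) ⟧ ≡ 0
    entry v with part v Fin.≟ i | colour v Fin.≟ j
    ... | no _  | _     = refl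
    ... | yes _ | no _  = refl
    ... | yes p | yes q = contradiction (v , p , q) empty

  module _ (G : SimpleGraph N) where
    open SimpleGraph G using (_~_; _~?_; degree)

    private
      pointwise-sum : ∀ v i j →
        sum (λ w → ⟦ does (v ~? w) ⟧ + (⟦ does (part w Fin.≟ i) ⟧ + ⟦ does (colour w Fin.≟ j) ⟧))
        ≡ degree v + (sum (λ w → ⟦ does (part w Fin.≟ i) ⟧) + sum (λ i′ → cell i′ j))
      pointwise-sum v i j = trans
        (∑-distrib-+ {N} (λ w → ⟦ does (v ~? w) ⟧) _)
        (cong₂ _+_ (sym (size-tabulate (λ w → does (v ~? w))))
          (trans (∑-distrib-+ {N} (λ w → ⟦ does (part w Fin.≟ i) ⟧) _)
            (cong (sum (λ w → ⟦ does (part w Fin.≟ i) ⟧) +_) (sym (column-total j)))))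

      cell-sum : ∀ i j →
        sum (λ v → 1 + ⟦ does (part v Fin.≟ i) ⟧ * ⟦ does (colour v Fin.≟ j) ⟧) ≡ N + cell i j
      cell-sum i j = trans (∑-distrib-+ {N} (λ _ → 1) _)
        (cong (_+ cell i j) (trans (sum-const N 1) (*-identityʳ N)))

    -- Inclusion-exclusion, checked vertex by vertex: the neighbourhood of `v` is disjoint from its
    -- part and from its colour class, which overlap in the cell of `v`.
    degree-upper : ∀ v → (∀ w → v ~ w → part v ≢ part w × colour v ≢ colour w) →
      degree v + (sum (λ w → ⟦ does (part w Fin.≟ part v) ⟧) + sum (λ i → cell i (colour v)))
      ≤ N + cell (part v) (colour v)
    degree-upper v separated = subst₂ _≤_ (pointwise-sum v _ _) (cell-sum _ _) (sum-mono λ w →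
      entry (v ~? w) (part w Fin.≟ part v) (colour w Fin.≟ colour v)
        (λ e p → proj₁ (separated w e) (sym p)) (λ e q → proj₂ (separated w e) (sym q)))
      where
      entry : {E P Q : Set} (e? : Dec E) (p? : Dec P) (q? : Dec Q) → (E → ¬ P) → (E → ¬ Q) →
        ⟦ does e? ⟧ + (⟦ does p? ⟧ + ⟦ does q? ⟧) ≤ 1 + ⟦ does p? ⟧ * ⟦ does q? ⟧
      entry (no _)  (no _)  q?      _ _ = ⟦⟧≤1 (does q?)
      entry (no _)  (yes _) q?      _ _ = ≤-reflexive (cong suc (sym (+-identityʳ _)))
      entry (yes _) (no _)  (no _)  _ _ = ≤-refl
      entry (yes e) (yes p) _       f _ = contradiction p (f e)
      entry (yes e) (no _)  (yes q) _ g = contradiction q (g e)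

    -- The converse count: neighbourhood, part and colour class together cover all vertices.
    degree-lower : ∀ v → (∀ w → part v ≢ part w → colour v ≢ colour w → v ~ w) →
      N + cell (part v) (colour v) ≤
      degree v + (sum (λ w → ⟦ does (part w Fin.≟ part v) ⟧) + sum (λ i → cell i (colour v)))
    degree-lower v joined = subst₂ _≤_ (cell-sum _ _) (pointwise-sum v _ _) (sum-mono λ w →
      entry (v ~? w) (part w Fin.≟ part v) (colour w Fin.≟ colour v)
        (λ p q → joined w (p ∘ sym) (q ∘ sym)))
      where
      entry : {E P Q : Set} (e? : Dec E) (p? : Dec P) (q? : Dec Q) → (¬ P → ¬ Q → E) →
        1 + ⟦ does p? ⟧ * ⟦ does q? ⟧ ≤ ⟦ does e? ⟧ + (⟦ does p? ⟧ + ⟦ does q? ⟧)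
      entry (yes _) (no _)  q?      _ = s≤s z≤n
      entry e?      (yes _) q?      _ = ≤-trans (≤-reflexive (cong suc (+-identityʳ _))) (m≤n+m _ ⟦ does e? ⟧)
      entry (no _)  (no _)  (yes _) _ = ≤-refl
      entry (no ¬e) (no ¬p) (no ¬q) f = contradiction (f ¬p ¬q) ¬e

module _ {N n r : ℕ} {G : SimpleGraph N} (P : BalancedPartition n r G) where

  open BalancedPartition P

  balanced-fibre : ∀ i → sum (λ v → ⟦ does (part v Fin.≟ i) ⟧) ≡ n
  balanced-fibre i = trans (sym (size-tabulate (λ v → does (part v Fin.≟ i)))) (size i)

  balanced-order : N ≡ r * n
  balanced-order = trans (sym (fibre-total part))
    (trans (sum-cong-≗ balanced-fibre) (sum-const r n))

module _ {N n r t′ m′ s T δ : ℕ} (G : SimpleGraph N) (P : BalancedPartition n r G)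
  (colouring : Colouring (3 + t′) G)
  where

  open SimpleGraph G using (_~_; degree)
  open BalancedPartition P
  open Cells part (proj₁ colouring)

  -- A vertex in the cell is a witness for the degree count. The second hypothesis is D ≥ (r - 1) n
  -- - δ without subtraction.
  coloured-column : ∀ {D} → (∀ v → δ ≤ degree v) → r * n ≤ n + δ + D →
    ∀ {i j} → 0 < cell i j → sum (λ i → cell i j) ≤ D + cell i j
  coloured-column {D} δ≤ D≥ 0<cell with cell-inhabited 0<cell
  ... | v , refl , refl = linear 0
    (degree-upper G v (λ w e → (λ p → independent p e) , (λ q → proj₂ colouring q e)) ⊕
     ≤-reflexive (sym (balanced-fibre P (part v))) ⊕ δ≤ v ⊕ ≤-reflexive (balanced-order P) ⊕ D≥)
    (identity (degree v) _ (sum (λ i → cell i (proj₁ colouring v))) N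
      (cell (part v) (proj₁ colouring v)) n δ (r * n) D)
    where
    identity : ∀ d p c N x n δ R D →
      c + (N + x + (p + (d + (R + (n + δ + D))))) + 0
      ≡ D + x + (d + (p + c) + (n + (δ + (N + R))))
    identity = solve-∀

  coloured⇒good : T < m′ → (3 + t′) * m′ < r → m′ * s + T < m′ * n →
    r * n ≤ n + δ + (m′ * s + T) → (∀ v → δ ≤ degree v) → Good n m′ (3 + t′) r s T
  coloured⇒good T<m′ many-rows D< D≥ δ≤ = Matrix.good cell
    (λ i → trans (row-total i) (balanced-fibre P i)) (coloured-column δ≤ D≥) T<m′ many-rows D<

attained⇒good : ∀ {n r t′ m′ s T δ} → let q = 2 + t′ ; D = m′ * s + T in
  T < m′ → suc q * m′ < r → D < m′ * n → r * n ≤ n + δ + D →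
  3 * q * (r * n) < (3 * q + 2) * δ + r * n →
  Attained n r (2 + q) δ → Good n m′ (suc q) r s T
attained⇒good {t′ = t′} {δ = δ} T<m′ many-rows D< D≥ dense (N , G , P , ¬clique , (_ , δ≤)) =
  coloured⇒good G P colouring T<m′ many-rows D< D≥ δ≤
  where
  q = 2 + t′
  colouring : Colouring (suc q) G
  colouring = dense⇒colourable q G (¬Clique⇒CliqueFree G ¬clique) δ≤
    (subst (λ N → 3 * q * N < (3 * q + 2) * δ + N) (sym (balanced-order P)) dense)

-- Lower bound

partite-graph : ∀ {N r t} → (Fin N → Fin r) → (Fin N → Fin t) → SimpleGraph N
partite-graph part colour = record
  { _~_    = λ u v → part u ≢ part v × colour u ≢ colour v
  ; sym    = λ (p , q) → p ∘ sym , q ∘ sym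
  ; irrefl = λ { refl (p , _) → p refl }
  ; _~?_   = λ u v → ¬? (part u Fin.≟ part v) ×-dec ¬? (colour u Fin.≟ colour v)
  }

partite-graph-¬Clique : ∀ {N r t} (part : Fin N → Fin r) (colour : Fin N → Fin t) →
  ¬ Clique (suc t) (partite-graph part colour)
partite-graph-¬Clique part colour (c , adjacent)
  with i , j , i<j , same ← Fin.pigeonhole ≤-refl (colour ∘ c) =
  proj₂ (adjacent i j (Fin.<⇒≢ i<j)) same

count-below : ∀ {n w} → w ≤ n → sum {n} (λ p → ⟦ does (toℕ p <? w) ⟧) ≡ w
count-below {n} {zero} _ = sum-zero {n} λ _ → refl
count-below {suc n} {suc w} (s≤s w≤n) = cong suc (count-below w≤n)

-- The rows of the first t₁ blocks of m split between the colour of their block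
-- and the common colour zero; w l is the width of the first piece.
module Construction
  {n m t₁ b s D : ℕ}
  (w : Fin m → ℕ) (w≤n : ∀ l → w l ≤ n) (s≤w : ∀ l → s ≤ w l) (w-total : sum w ≡ D + s)
  (last≤ : (t₁ * m + b) * n + s ≤ t₁ * (D + s) + D + n)
  (rest≤ : ∀ l → w l < n → (t₁ * m + b) * n + w l ≤ t₁ * (D + s) + D + n)
  where

  r : ℕ
  r = t₁ * m + b

  split-colour : Fin t₁ × Fin m → Fin n → Fin (suc t₁)
  split-colour (j , l) p = if does (toℕ p <? w l) then suc j else zero

  row-colour : (Fin t₁ × Fin m) ⊎ Fin b → Fin n → Fin (suc t₁)
  row-colour (inj₁ jl) = split-colour jl
  row-colour (inj₂ _)  = λ _ → zero

  row : Fin r → (Fin t₁ × Fin m) ⊎ Fin b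
  row i = [ inj₁ ∘ remQuot m , inj₂ ]′ (splitAt (t₁ * m) i)

  part : Fin (r * n) → Fin r
  part v = proj₁ (remQuot n v)

  colour : Fin (r * n) → Fin (suc t₁)
  colour v = row-colour (row (part v)) (proj₂ (remQuot {r} n v))

  open Cells part colour

  G = partite-graph part colour

  part-size : ∀ i → sum (λ v → ⟦ does (part v Fin.≟ i) ⟧) ≡ n
  part-size i = begin
    sum (λ v → ⟦ does (part v Fin.≟ i) ⟧)                ≡⟨ sum-remQuot r n (λ ip → ⟦ does (proj₁ ip Fin.≟ i) ⟧) ⟩
    sum (λ i′ → sum {n} (λ _ → ⟦ does (i′ Fin.≟ i) ⟧))   ≡⟨ sum-cong-≗ (λ i′ → trans (sum-const n ⟦ does (i′ Fin.≟ i) ⟧) (*-comm n _)) ⟩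
    sum (λ i′ → ⟦ does (i′ Fin.≟ i) ⟧ * n)               ≡⟨ sum-indicator i (λ _ → n) ⟩
    n                                                    ∎
    where open ≡-Reasoning

  balanced : BalancedPartition n r G
  balanced = record
    { part = part
    ; independent = λ same (p , _) → p same
    ; size = λ i → trans (size-tabulate (λ v → does (part v Fin.≟ i))) (part-size i)
    }

  pieces : (Fin t₁ × Fin m) ⊎ Fin b → Fin (suc t₁) → ℕ
  pieces ρ j = sum (λ p → ⟦ does (row-colour ρ p Fin.≟ j) ⟧)

  cell≡pieces : ∀ i j → cell i j ≡ pieces (row i) j
  cell≡pieces i j = begin
    cell i j
      ≡⟨ sum-remQuot r n (λ (i′ , p) → ⟦ does (i′ Fin.≟ i) ⟧ * ⟦ does (row-colour (row i′) p Fin.≟ j) ⟧) ⟩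
    sum (λ i′ → sum (λ p → ⟦ does (i′ Fin.≟ i) ⟧ * ⟦ does (row-colour (row i′) p Fin.≟ j) ⟧))
      ≡⟨ sum-cong-≗ (λ i′ → *-distribˡ-sum ⟦ does (i′ Fin.≟ i) ⟧ (λ p → ⟦ does (row-colour (row i′) p Fin.≟ j) ⟧)) ⟨
    sum (λ i′ → ⟦ does (i′ Fin.≟ i) ⟧ * pieces (row i′) j)
      ≡⟨ sum-indicator i (λ i′ → pieces (row i′) j) ⟩
    pieces (row i) j ∎
    where open ≡-Reasoning

  block-piece : ∀ j l j′ → pieces (inj₁ (j , l)) (suc j′) ≡ ⟦ does (j Fin.≟ j′) ⟧ * w l
  block-piece j l j′ = begin
    sum (λ p → ⟦ does (split-colour (j , l) p Fin.≟ suc j′) ⟧)             ≡⟨ sum-cong-≗ entry ⟩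
    sum (λ (p : Fin n) → ⟦ does (j Fin.≟ j′) ⟧ * ⟦ does (toℕ p <? w l) ⟧)  ≡⟨ *-distribˡ-sum ⟦ does (j Fin.≟ j′) ⟧ (λ (p : Fin n) → ⟦ does (toℕ p <? w l) ⟧) ⟨
    ⟦ does (j Fin.≟ j′) ⟧ * sum (λ (p : Fin n) → ⟦ does (toℕ p <? w l) ⟧)  ≡⟨ cong (⟦ does (j Fin.≟ j′) ⟧ *_) (count-below (w≤n l)) ⟩
    ⟦ does (j Fin.≟ j′) ⟧ * w l                                            ∎
    where
    open ≡-Reasoning
    entry : ∀ p → ⟦ does (split-colour (j , l) p Fin.≟ suc j′) ⟧
                ≡ ⟦ does (j Fin.≟ j′) ⟧ * ⟦ does (toℕ p <? w l) ⟧
    entry p with does (toℕ p <? w l)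
    ... | true  = trans (⟦⟧-cong (suc j Fin.≟ suc j′) (j Fin.≟ j′) Fin.suc-injective (cong suc))
                    (sym (*-identityʳ _))
    ... | false = sym (*-zeroʳ ⟦ does (j Fin.≟ j′) ⟧)

  rest-piece : ∀ j l → pieces (inj₁ (j , l)) zero + w l ≡ n
  rest-piece j l = begin
    pieces (inj₁ (j , l)) zero + w l
      ≡⟨ cong (pieces (inj₁ (j , l)) zero +_) (count-below (w≤n l)) ⟨
    pieces (inj₁ (j , l)) zero + sum (λ (p : Fin n) → ⟦ does (toℕ p <? w l) ⟧)
      ≡⟨ ∑-distrib-+ {n} (λ p → ⟦ does (split-colour (j , l) p Fin.≟ zero) ⟧) _ ⟨
    sum (λ p → ⟦ does (split-colour (j , l) p Fin.≟ zero) ⟧ + ⟦ does (toℕ p <? w l) ⟧)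
      ≡⟨ sum-cong-≗ entry ⟩
    sum {n} (λ _ → 1)
      ≡⟨ trans (sum-const n 1) (*-identityʳ n) ⟩
    n ∎
    where
    open ≡-Reasoning
    entry : ∀ p → ⟦ does (split-colour (j , l) p Fin.≟ zero) ⟧ + ⟦ does (toℕ p <? w l) ⟧ ≡ 1
    entry p with does (toℕ p <? w l)
    ... | true  = refl
    ... | false = refl

  sum-rows : ∀ (f : (Fin t₁ × Fin m) ⊎ Fin b → ℕ) →
    sum (λ i → f (row i)) ≡ sum (λ j → sum (λ l → f (inj₁ (j , l)))) + sum (f ∘ inj₂)
  sum-rows f = trans
    (sum-splitAt (t₁ * m) (f ∘ [ inj₁ ∘ remQuot m , inj₂ ]′))
    (cong (_+ sum (f ∘ inj₂)) (sum-remQuot t₁ m (f ∘ inj₁)))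

  column : Fin (suc t₁) → ℕ
  column j = sum (λ i → cell i j)

  block-column : ∀ j → column (suc j) ≡ D + s
  block-column j = begin
    column (suc j)
      ≡⟨ sum-cong-≗ (λ i → cell≡pieces i (suc j)) ⟩
    sum (λ i → pieces (row i) (suc j))
      ≡⟨ sum-rows (λ ρ → pieces ρ (suc j)) ⟩
    sum (λ j′ → sum (λ l → pieces (inj₁ (j′ , l)) (suc j))) + sum {b} (λ _ → sum {n} (λ _ → 0))
      ≡⟨ cong₂ _+_
           (sum-cong-≗ λ j′ → trans (sum-cong-≗ λ l → block-piece j′ l j)
             (sym (*-distribˡ-sum ⟦ does (j′ Fin.≟ j) ⟧ w)))
           (sum-zero {b} λ _ → sum-zero {n} λ _ → refl) ⟩
    sum (λ j′ → ⟦ does (j′ Fin.≟ j) ⟧ * sum w) + 0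
      ≡⟨ trans (+-identityʳ _) (sum-indicator j (λ _ → sum w)) ⟩
    sum w
      ≡⟨ w-total ⟩
    D + s ∎
    where open ≡-Reasoning

  last-column : column zero + t₁ * (D + s) ≡ r * n
  last-column = begin
    column zero + t₁ * (D + s)                 ≡⟨ cong (column zero +_) (trans (sum-cong-≗ block-column) (sum-const t₁ (D + s))) ⟨
    sum column                                 ≡⟨ ∑-comm (λ j i → cell i j) ⟩
    sum (λ i → sum (cell i))                   ≡⟨ sum-cong-≗ (λ i → trans (row-total i) (part-size i)) ⟩
    sum {r} (λ _ → n)                          ≡⟨ sum-const r n ⟩
    r * n                                      ∎
    where open ≡-Reasoning

  -- A block colour has D + s vertices and pieces of at least s. Colour zero has r n - t₁ (D + s)
  -- vertices; `rest≤` bounds this for a nonempty remainder of size n - w l, and `last≤` for an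
  -- uncut row of size n.
  column≤ : ∀ ρ p → let j = row-colour ρ p in column j ≤ D + pieces ρ j
  column≤ (inj₁ (j , l)) p = cases (toℕ p <? w l)
    where
    Bounded : Fin (suc t₁) → Set
    Bounded j′ = column j′ ≤ D + pieces (inj₁ (j , l)) j′
    first : Bounded (suc j)
    first = begin
      column (suc j)                         ≡⟨ block-column j ⟩
      D + s                                  ≤⟨ +-monoʳ-≤ D (s≤w l) ⟩
      D + w l                                ≡⟨ cong (D +_) (trans (cong (_* w l) (⟦yes⟧ (j Fin.≟ j) refl)) (+-identityʳ (w l))) ⟨
      D + ⟦ does (j Fin.≟ j) ⟧ * w l         ≡⟨ cong (D +_) (block-piece j l j) ⟨
      D + pieces (inj₁ (j , l)) (suc j)      ∎
      where open ≤-Reasoning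
    last : w l < n → Bounded zero
    last w<n = linear 0
      (rest≤ l w<n ⊕ ≤-reflexive last-column ⊕ ≤-reflexive (sym (rest-piece j l)))
      (identity (column zero) D (pieces (inj₁ (j , l)) zero) (r * n) (w l) (t₁ * (D + s)) n)
      where
      identity : ∀ c D x R w k n → c + (k + D + n + (R + (x + w))) + 0 ≡ D + x + (R + w + (c + k + n))
      identity = solve-∀
    choose : Bool → Fin (suc t₁)
    choose first? = if first? then suc j else zero
    cases : Dec (toℕ p < w l) → Bounded (split-colour (j , l) p)
    cases (yes p<w) = subst (Bounded ∘ choose) (sym (dec-true (toℕ p <? w l) p<w)) first
    cases (no p≮w)  = subst (Bounded ∘ choose) (sym (dec-false (toℕ p <? w l) p≮w))
      (last (≤-<-trans (≮⇒≥ p≮w) (Fin.toℕ<n p)))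
  column≤ (inj₂ i) p = linear s
    (last≤ ⊕ ≤-reflexive last-column ⊕ ≤-reflexive (sym (trans (sum-const n 1) (*-identityʳ n))))
    (identity (column zero) D (pieces (inj₂ i) zero) (r * n) s (t₁ * (D + s)) n)
    where
    identity : ∀ c D x R s k n → c + (k + D + n + (R + x)) + s ≡ D + x + (R + s + (c + k + n))
    identity = solve-∀

  degree≥ : ∀ v → r * n ≤ n + D + SimpleGraph.degree G v
  degree≥ v = linear 0
    (degree-lower G v (λ w p q → p , q) ⊕ ≤-reflexive (part-size (part v)) ⊕
     column≤ (row (part v)) (proj₂ (remQuot {r} n v)) ⊕
     ≤-reflexive (sym (cell≡pieces (part v) (colour v))))
    (identity (SimpleGraph.degree G v) _ (column (colour v)) (r * n)
      (cell (part v) (colour v)) n D (pieces (row (part v)) (colour v)))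
    where
    identity : ∀ d p c R x n D y →
      R + (d + (p + c) + (n + (D + y + x))) + 0 ≡ n + D + d + (R + x + (p + (c + y)))
    identity = solve-∀

  attained : 0 < r * n → ∃[ δ ] r * n ≤ n + D + δ × Attained n r (suc (suc t₁)) δ
  attained 0<rn =
    let v , minimal = ∃-minimum 0<rn (SimpleGraph.degree G)
    in SimpleGraph.degree G v , degree≥ v ,
       r * n , G , balanced , partite-graph-¬Clique part colour , (v , refl) , minimal

-- In each block q of the pieces have width s + g and the others width s; as q g = T, a block adds
-- up to D + s. The condition `strict` concerns only wide pieces that leave a remainder.
module Widths
  {n m′ t₁ b s T : ℕ}
  (0<n : 0 < n) (0<r : 0 < t₁ * suc m′ + b) (s≤n : s ≤ n)
  (h : (t₁ * suc m′ + b) * n + 2 * s ≤ n + suc t₁ * (m′ * s + T + s))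
  (q g : ℕ) (q≤m : q ≤ suc m′) (qg≡T : q * g ≡ T) (s+g≤n : 0 < q → s + g ≤ n)
  (strict : 0 < q → s + g < n →
    (t₁ * suc m′ + b) * n + 2 * s + g ≤ n + suc t₁ * (m′ * s + T + s))
  where

  m D r : ℕ
  m = suc m′
  D = m′ * s + T
  r = t₁ * m + b

  width : Fin m → ℕ
  width l = s + ⟦ does (toℕ l <? q) ⟧ * g

  width-case : (P : ℕ → Set) → P s → (0 < q → P (s + g)) → ∀ l → P (width l)
  width-case P Ps Ps+g l = cases (toℕ l <? q)
    where
    cases : Dec (toℕ l < q) → P (width l)
    cases (yes l<q) = subst P (sym (cong (s +_)
      (trans (cong (_* g) (⟦yes⟧ (toℕ l <? q) l<q)) (+-identityʳ g)))) (Ps+g (≤-<-trans z≤n l<q))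
    cases (no l≮q)  = subst P (sym (trans
      (cong (λ e → s + e * g) (⟦no⟧ (toℕ l <? q) l≮q)) (+-identityʳ s))) Ps

  width-total : sum width ≡ D + s
  width-total = begin
    sum width
      ≡⟨ ∑-distrib-+ {m} (λ _ → s) (λ l → ⟦ does (toℕ l <? q) ⟧ * g) ⟩
    sum {m} (λ _ → s) + sum (λ (l : Fin m) → ⟦ does (toℕ l <? q) ⟧ * g)
      ≡⟨ cong₂ _+_ (sum-const m s) (sym (*-distribʳ-sum g (λ (l : Fin m) → ⟦ does (toℕ l <? q) ⟧))) ⟩
    m * s + sum (λ (l : Fin m) → ⟦ does (toℕ l <? q) ⟧) * g
      ≡⟨ cong (λ k → m * s + k * g) (count-below q≤m) ⟩
    m * s + q * g
      ≡⟨ cong (m * s +_) qg≡T ⟩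
    m * s + T
      ≡⟨ identity m′ s T ⟩
    D + s ∎
    where
    open ≡-Reasoning
    identity : ∀ m s T → suc m * s + T ≡ m * s + T + s
    identity = solve-∀

  attained : ∃[ δ ] r * n ≤ n + D + δ × Attained n r (suc (suc t₁)) δ
  attained = Construction.attained width
    (width-case (_≤ n) s≤n s+g≤n)
    (λ l → m≤m+n s _)
    width-total
    last
    (width-case (λ w → w < n → r * n + w ≤ t₁ * (D + s) + D + n) (λ _ → last)
      λ 0<q s+g<n → linear 0 (strict 0<q s+g<n) (identity′ (r * n) s g n t₁ D))
    (*-mono-≤ 0<r 0<n)
    where
    identity : ∀ R s n t D → R + s + (n + suc t * (D + s)) + 0 ≡ t * (D + s) + D + n + (R + 2 * s)
    identity = solve-∀
    last : r * n + s ≤ t₁ * (D + s) + D + n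
    last = linear 0 h (identity (r * n) s n t₁ D)
    identity′ : ∀ R s g n t D →
      R + (s + g) + (n + suc t * (D + s)) + 0 ≡ t * (D + s) + D + n + (R + 2 * s + g)
    identity′ = solve-∀

good⇒attained : ∀ {n m′ t₁ b s T} → let D = m′ * s + T ; r = t₁ * suc m′ + b in
  0 < n → 0 < r → T < m′ → D ≤ m′ * n → Good n m′ (suc t₁) r s T →
  ∃[ δ ] r * n ≤ n + D + δ × Attained n r (suc (suc t₁)) δ
good⇒attained {n} {m′} {t₁} {b} {s} {T} 0<n 0<r T<m′ D≤ good = cases good
  where
  D r : ℕ
  D = m′ * s + T
  r = t₁ * suc m′ + b
  s≤n : s ≤ n
  s≤n = *-cancelˡ-≤ m′ {{>-nonZero (≤-<-trans z≤n T<m′)}} (≤-trans (m≤m+n (m′ * s) T) D≤)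
  0<T⇒s<n : 0 < T → s < n
  0<T⇒s<n 0<T = *-cancelˡ-< m′ s n (<-≤-trans (m<m+n (m′ * s) 0<T) D≤)
  T≤m : T ≤ suc m′
  T≤m = ≤-trans (<⇒≤ T<m′) (n≤1+n m′)
  cases : Good n m′ (suc t₁) r s T →
    ∃[ δ ] r * n ≤ n + D + δ × Attained n r (suc (suc t₁)) δ
  -- H > 0 leaves room for one extra vertex, so T pieces get width s + 1.
  cases (inj₁ h) = Widths.attained 0<n 0<r s≤n (<⇒≤ h) T 1 T≤m (*-identityʳ T)
    (λ 0<T → ≤-trans (≤-reflexive (+-comm s 1)) (0<T⇒s<n 0<T))
    (λ _ _ → ≤-trans (≤-reflexive (+-comm _ 1)) h)
  cases (inj₂ (h , divides q T≡qg)) with n ∸ s ≟ 0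
  -- Here s = n, which forces T = 0: there are no wide pieces and no remainders.
  ... | yes g≡0 = Widths.attained 0<n 0<r s≤n (≤-reflexive h) 0 0 z≤n
          (sym (trans T≡qg (trans (cong (q *_) g≡0) (*-zeroʳ q)))) (λ ()) (λ ())
  -- With H = 0 the wide pieces are whole rows of width n, so they contribute nothing to colour
  -- zero.
  ... | no g≢0 = Widths.attained 0<n 0<r s≤n (≤-reflexive h) q (n ∸ s)
          (≤-trans (≤-trans (m≤m*n q (n ∸ s) {{≢-nonZero g≢0}}) (≤-reflexive (sym T≡qg))) T≤m)
          (sym T≡qg)
          (λ _ → ≤-reflexive (m+[n∸m]≡n s≤n))
          (λ _ s+g<n → contradiction (m+[n∸m]≡n s≤n) (<⇒≢ s+g<n))

-- "H < 0, or H = 0 and (n − s) ∤ T", with r n moved to the other side.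
Bad : (n t r d s T : ℕ) → Set
Bad n t r d s T = let P = n + t * d + (t ∸ 2) * s in
  P < r * n ⊎ (P ≡ r * n × ¬ (n ∸ s) ∣ T)

module _ {n m′ t′ r s T : ℕ} where

  private
    t D P : ℕ
    t = 3 + t′
    D = m′ * s + T
    P = n + t * D + suc t′ * s

    shift : P + 2 * s ≡ n + t * (D + s)
    shift = identity n t′ D s
      where
      identity : ∀ n t D s → n + (3 + t) * D + suc t * s + 2 * s ≡ n + (3 + t) * (D + s)
      identity = solve-∀

  ¬bad⇒good : ¬ Bad n t r D s T → Good n m′ t r s T
  ¬bad⇒good ¬bad with <-cmp P (r * n)
  ... | tri< P<rn _ _ = contradiction (inj₁ P<rn) ¬bad
  ... | tri> _ _ rn<P = inj₁ (<-≤-trans (+-monoˡ-< (2 * s) rn<P) (≤-reflexive shift))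
  ... | tri≈ _ P≡rn _ with (n ∸ s) ∣? T
  ...   | yes g∣T = inj₂ (trans (cong (_+ 2 * s) (sym P≡rn)) shift , g∣T)
  ...   | no g∤T  = contradiction (inj₂ (P≡rn , g∤T)) ¬bad

  good⇒¬bad : Good n m′ t r s T → ¬ Bad n t r D s T
  good⇒¬bad (inj₁ h) (inj₁ P<rn) = <-asym P<rn
    (+-cancelʳ-< (2 * s) (r * n) P (<-≤-trans h (≤-reflexive (sym shift))))
  good⇒¬bad (inj₁ h) (inj₂ (P≡rn , _)) = <⇒≢ h (trans (cong (_+ 2 * s) (sym P≡rn)) shift)
  good⇒¬bad (inj₂ (h , _)) (inj₁ P<rn) = <⇒≢ (+-monoˡ-< (2 * s) P<rn) (trans shift (sym h))
  good⇒¬bad (inj₂ (_ , g∣T)) (inj₂ (_ , g∤T)) = g∤T g∣T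

  good⇒≤ : Good n m′ t r s T → r * n + 2 * s ≤ n + t * (D + s)
  good⇒≤ (inj₁ h)       = <⇒≤ h
  good⇒≤ (inj₂ (h , _)) = ≤-reflexive h

-- The least good D

module Extremal
  {n m″ t′ a r₁ : ℕ}
  (0<n : 0 < n) (2≤a : 2 ≤ a) (a≤m : a ≤ 2 + m″) (a<t : a < 3 + t′)
  (r+a≡mt : suc r₁ + a ≡ (2 + m″) * (3 + t′))
  where

  m′ m t r : ℕ
  m′ = suc m″
  m  = suc m′
  t  = 3 + t′
  r  = suc r₁

  -- m t − 2
  K : ℕ
  K = m′ * t + suc t′

  GoodAt : ℕ → Set
  GoodAt D = Good n m′ t r (D / m′) (D % m′)

  division : ∀ D → m′ * (D / m′) + D % m′ ≡ D
  division D = trans (+-comm (m′ * (D / m′)) (D % m′))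
    (trans (cong (D % m′ +_) (*-comm m′ (D / m′))) (sym (m≡m%n+[m/n]*n D m′)))

  many-rows : t * m′ < r
  many-rows = linear 0 (a<t ⊕ ≤-reflexive (sym r+a≡mt)) (identity m′ t′ r a)
    where
    identity : ∀ m t r a → suc ((3 + t) * m) + (3 + t + (r + a)) + 0 ≡ r + (suc a + suc m * (3 + t))
    identity = solve-∀

  0<r₁ : 0 < r₁
  0<r₁ = s≤s⁻¹ (≤-trans (s≤s (≤-trans (s≤s z≤n) (m≤n*m m′ t))) many-rows)

  -- Multiplying by m′ and replacing m′ s by D - T turns the inequality into K D ≥ m′ (r - 1) n + (t
  -- - 2) T. Dropping the last term shows that a good D is at least d.
  good⇒K : ∀ {s T} → Good n m′ t r s T → m′ * r₁ * n ≤ K * (m′ * s + T)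
  good⇒K {s} {T} good = linear (suc t′ * T) (m′ ⊛ good⇒≤ {n} {m′} {t′} {r} {s} {T} good) (identity m′ r₁ n s T t′)
    where
    identity : ∀ m r n s T t →
      m * r * n + m * (n + (3 + t) * (m * s + T + s)) + suc t * T
      ≡ (m * (3 + t) + suc t) * (m * s + T) + m * (suc r * n + 2 * s)
    identity = solve-∀

  -- The lost term (t - 2) T is smaller than K, so one more unit of D restores strict inequality.
  -- Hence the least good D is d or d + 1.
  K⇒good : ∀ {s T} → T < m′ → m′ * r₁ * n + K ≤ K * (m′ * s + T) → Good n m′ t r s T
  K⇒good {s} {T} T<m′ h = inj₁ (*-cancelˡ-< m′ _ _
    (linear (2 * m′ + t′) (h ⊕ (suc t′ ⊛ <⇒≤ T<m′)) (identity m′ r₁ n s T t′)))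
    where
    identity : ∀ m r n s T t →
      suc (m * (suc r * n + 2 * s)) + ((m * (3 + t) + suc t) * (m * s + T) + suc t * m) + (2 * m + t)
      ≡ m * (n + (3 + t) * (m * s + T + s)) + (m * r * n + (m * (3 + t) + suc t) + suc t * T)
    identity = solve-∀

  r+1<mt : suc r < m * t
  r+1<mt = ≤-trans (≤-reflexive (+-comm 2 r)) (≤-trans (+-monoʳ-≤ r 2≤a) (≤-reflexive r+a≡mt))

  r₁≤K : r₁ ≤ K
  r₁≤K = linear 1 r+1<mt (identity r₁ m′ t′)
    where
    identity : ∀ r m t → r + suc m * (3 + t) + 1 ≡ m * (3 + t) + suc t + suc (suc (suc r))
    identity = solve-∀

  d≤ : ∀ {d} → K * d < m′ * r₁ * n + K → d ≤ m′ * n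
  d≤ {d} d-upper = s≤s⁻¹ (*-cancelˡ-< K d (suc (m′ * n)) (<-≤-trans d-upper
    (linear 0 ((m′ * n) ⊛ r₁≤K) (identity m′ r₁ n K))))
    where
    identity : ∀ m r n K → m * r * n + K + m * n * K + 0 ≡ K * suc (m * n) + m * n * r
    identity = solve-∀

  Cases : ℕ → ℕ → Set
  Cases d e = e ≡ 0 × ¬ Bad n t r d (d / m′) (d % m′) ⊎ e ≡ 1 × Bad n t r d (d / m′) (d % m′)

  module _ {d F e : ℕ}
    (d-lower : m′ * r₁ * n ≤ K * d) (d-upper : K * d < m′ * r₁ * n + K)
    (ε-cases : Cases d e)
    (F+d+e≡ : F + (d + e) ≡ r₁ * n)
    (dense : 3 * (2 + t′) * (r * n) < (3 * (2 + t′) + 2) * suc F + r * n)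
    where

    X : ℕ
    X = d + e

    -- Here s = n and T = 0. When d is bad this gives d ≠ m′ n, so that d + 1 still does not exceed
    -- m′ n.
    m′n-good : GoodAt (m′ * n)
    m′n-good = subst₂ (Good n m′ t r)
      (sym (trans (cong (_/ m′) (*-comm m′ n)) (m*n/n≡m n m′)))
      (sym (trans (cong (_% m′) (*-comm m′ n)) (m*n%n≡0 n m′)))
      (inj₁ (linear 0 ((n ⊛ r+1<mt) ⊕ 0<n) (identity r n m′ t′)))
      where
      identity : ∀ r n m t → suc (r * n + 2 * n) + (n * (suc m * (3 + t)) + n) + 0
        ≡ n + (3 + t) * (m * n + 0 + n) + (n * suc (suc r) + 1)
      identity = solve-∀

    good-bad : GoodAt d → ¬ Bad n t r d (d / m′) (d % m′)
    good-bad good = subst (λ d′ → ¬ Bad n t r d′ (d / m′) (d % m′)) (division d)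
      (good⇒¬bad {n} {m′} {t′} {r} {d / m′} {d % m′} good)

    X≤ : X ≤ m′ * n
    X≤ = cases ε-cases
      where
      cases : Cases d e → X ≤ m′ * n
      cases (inj₁ (refl , _))   = ≤-trans (≤-reflexive (+-identityʳ d)) (d≤ d-upper)
      cases (inj₂ (refl , bad)) = ≤-trans (≤-reflexive (+-comm d 1))
        (≤∧≢⇒< (d≤ d-upper) λ d≡ → good-bad (subst GoodAt (sym d≡) m′n-good) bad)

    X-good : GoodAt X
    X-good = cases ε-cases
      where
      identity : ∀ a K d → a + K + K * d + 0 ≡ K * (d + 1) + a
      identity = solve-∀
      cases : Cases d e → GoodAt X
      cases (inj₁ (refl , ¬bad)) = subst GoodAt (sym (+-identityʳ d))
        (¬bad⇒good {n} {m′} {t′} {r} {d / m′} {d % m′} (subst (λ d′ → ¬ Bad n t r d′ (d / m′) (d % m′)) (sym (division d)) ¬bad))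
      cases (inj₂ (refl , _)) = K⇒good {(d + 1) / m′} {(d + 1) % m′} (m%n<n (d + 1) m′)
        (subst (λ D → m′ * r₁ * n + K ≤ K * D) (sym (division (d + 1)))
          (linear 0 d-lower (identity (m′ * r₁ * n) K d)))

    -- The ceiling d is a lower bound for every good D, and when ε is 1 the value d itself is bad.
    good⇒X≤ : ∀ {D} → GoodAt D → X ≤ D
    good⇒X≤ {D} good = cases ε-cases
      where
      d≤D : d ≤ D
      d≤D = s≤s⁻¹ (*-cancelˡ-< K d (suc D) (<-≤-trans d-upper (begin
        m′ * r₁ * n + K   ≤⟨ +-monoˡ-≤ K (subst (λ D′ → m′ * r₁ * n ≤ K * D′) (division D)
                               (good⇒K {D / m′} {D % m′} good)) ⟩
        K * D + K         ≡⟨ +-comm (K * D) K ⟩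
        K + K * D         ≡⟨ *-suc K D ⟨
        K * suc D         ∎)))
        where open ≤-Reasoning
      cases : Cases d e → X ≤ D
      cases (inj₁ (refl , _)) = ≤-trans (≤-reflexive (+-identityʳ d)) d≤D
      cases (inj₂ (refl , bad)) = ≤-trans (≤-reflexive (+-comm d 1))
        (≤∧≢⇒< d≤D λ d≡D → good-bad (subst GoodAt (sym d≡D) good) bad)

    0<X : 0 < X
    0<X = ≤-trans (n≢0⇒n>0 d≢0) (m≤m+n d e)
      where
      d≢0 : d ≢ 0
      d≢0 refl = <⇒≱ (*-mono-≤ (*-mono-≤ (s≤s {0} {m″} z≤n) 0<r₁) 0<n)
        (≤-trans d-lower (≤-reflexive (*-zeroʳ K)))

    attained≤F : ∀ δ → Attained n r (suc t) δ → δ ≤ F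
    attained≤F δ att = ≮⇒≥ λ F<δ →
      -- Truncation is harmless: if δ exceeds (r - 1) n then D = 0, which is still below X and still
      -- satisfies r n ≤ n + δ + D.
      let D = r₁ * n ∸ δ
          D<X : D < X
          D<X = m<n+o⇒m∸n<o (r₁ * n) δ {{>-nonZero 0<X}}
            (<-≤-trans (≤-reflexive (cong suc (sym F+d+e≡))) (+-monoˡ-≤ X F<δ))
          E = division D
      in <⇒≱ D<X (good⇒X≤ (attained⇒good (m%n<n D m′) many-rows
        (subst (_< m′ * n) (sym E) (<-≤-trans D<X X≤))
        (subst (λ D → r * n ≤ n + δ + D) (sym E)
          (≤-trans (+-monoʳ-≤ n (m≤n+m∸n (r₁ * n) δ)) (≤-reflexive (sym (+-assoc n δ _)))))
        (<-≤-trans dense (+-monoˡ-≤ (r * n) (*-monoʳ-≤ (3 * (2 + t′) + 2) F<δ)))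
        att))

    -- The shape used by the construction: t - 1 blocks of m parts and m - a uncut parts.
    blocks : r ≡ (2 + t′) * m + (m ∸ a)
    blocks = +-cancelʳ-≡ a _ _ (begin
      r + a                              ≡⟨ r+a≡mt ⟩
      m * t                              ≡⟨ identity m t′ ⟩
      (2 + t′) * m + m                   ≡⟨ cong ((2 + t′) * m +_) (m∸n+n≡m a≤m) ⟨
      (2 + t′) * m + (m ∸ a + a)         ≡⟨ +-assoc ((2 + t′) * m) (m ∸ a) a ⟨
      (2 + t′) * m + (m ∸ a) + a         ∎)
      where
      open ≡-Reasoning
      identity : ∀ m t → m * (3 + t) ≡ (2 + t) * m + m
      identity = solve-∀

    attained : ∃[ δ ] r * n ≤ n + X + δ × Attained n r (suc t) δ
    attained = subst₂ (λ r X → ∃[ δ ] r * n ≤ n + X + δ × Attained n r (suc t) δ)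
      (sym blocks) (division X)
      (good⇒attained {s = X / m′} {T = X % m′} 0<n (subst (0 <_) blocks z<s) (m%n<n X m′)
        (subst (_≤ m′ * n) (sym (division X)) X≤)
        (subst (λ r → Good n m′ t r (X / m′) (X % m′)) blocks X-good))

    -- The construction only promises minimum degree at least F; the upper bound turns this into
    -- equality.
    extremal : f[ n , r , suc t ]≡ F
    extremal =
      let δ , δ≥ , att = attained
          F≤δ : F ≤ δ
          F≤δ = linear 0 (δ≥ ⊕ ≤-reflexive F+d+e≡) (identity F n X δ r₁)
      in subst (Attained n r (suc t)) (≤-antisym (attained≤F δ att) F≤δ) att , attained≤F
      where
      identity : ∀ F n X δ r → F + (n + X + δ + r * n) + 0 ≡ δ + (suc r * n + (F + X))
      identity = solve-∀

-- From integers to natural numbers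

open import Data.Integer as ℤ using (ℤ; +_; 0ℤ; 1ℤ)
import Data.Integer.DivMod as ℤ
open import Data.Integer.Divisibility.Signed as Signed using (∣⇒∣ᵤ; ∣ᵤ⇒∣)
import Data.Integer.Properties as ℤ

floor-+ : ∀ {z A} B .{{_ : NonZero B}} → z ≡ + A → floor (z ℚᵘ./ B) ≡ + (A / B)
floor-+ {A = A} (suc b) refl = ℤ.div-pos-is-/ℕ (+ A) (suc b)

-- A ceiling is the negated floor of the negated fraction. Integer division rounds -A down, so a
-- nonzero remainder moves the quotient one step away from zero.
negative-/ : ∀ A b →
  ∃[ c ] (ℤ.- + A) ℤ./ℕ suc b ≡ ℤ.- + c × A ≤ suc b * c × suc b * c < A + suc b
negative-/ zero    b = 0 , refl , z≤n , s≤s (≤-trans (≤-reflexive (*-zeroʳ b)) z≤n)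
negative-/ (suc A) b with suc A % suc b | m≡m%n+[m/n]*n (suc A) (suc b) | m%n<n (suc A) (suc b)
... | zero | A≡ | _ = q , refl , ≤-reflexive A≡Bq ,
        ≤-trans (s≤s (≤-reflexive (sym A≡Bq))) (m<m+n (suc A) z<s)
  where
  q = suc A / suc b
  A≡Bq : suc A ≡ suc b * q
  A≡Bq = trans A≡ (*-comm q (suc b))
... | suc ρ | A≡ | ρ<b = suc q , refl ,
        linear 0 (≤-reflexive A≡ ⊕ <⇒≤ ρ<b) (upper A ρ q b) ,
        linear ρ (≤-reflexive (sym A≡)) (lower A ρ q b)
  where
  q = suc A / suc b
  upper : ∀ A ρ q b → suc A + (suc ρ + q * suc b + suc b) + 0 ≡ suc b * suc q + (suc A + suc ρ)
  upper = solve-∀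
  lower : ∀ A ρ q b → suc (suc b * suc q) + suc A + ρ ≡ suc A + suc b + (suc ρ + q * suc b)
  lower = solve-∀

ceiling-+ : ∀ {z A} B .{{_ : NonZero B}} → z ≡ + A →
  ∃[ c ] ceiling (z ℚᵘ./ B) ≡ + c × A ≤ B * c × B * c < A + B
ceiling-+ {A = A} (suc b) refl =
  let c , /≡ , bounds = negative-/ A b
  in c , trans (cong ℤ.-_ (trans (ℤ.div-pos-is-/ℕ (ℤ.- + A) (suc b)) /≡)) (ℤ.neg-involutive (+ c)) , bounds

+-∸ : ∀ {m n} → n ≤ m → + m ℤ.- + n ≡ + (m ∸ n)
+-∸ {m} {n} n≤m = trans (ℤ.[+m]-[+n]≡m⊖n m n) (ℤ.⊖-≥ n≤m)

BadInteger : (H x T : ℤ) → Set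
BadInteger H x T = H ℤ.< 0ℤ ⊎ H ≡ 0ℤ × ¬ x Signed.∣ T

bad⇔ : ∀ {P Q g T H} → H ≡ + P ℤ.- + Q →
  (BadInteger H (+ g) (+ T) → P < Q ⊎ P ≡ Q × ¬ g ∣ T) ×
  (P < Q ⊎ P ≡ Q × ¬ g ∣ T → BadInteger H (+ g) (+ T))
bad⇔ {P} {Q} {g} {T} refl = to , from
  where
  to : BadInteger (+ P ℤ.- + Q) (+ g) (+ T) → P < Q ⊎ P ≡ Q × ¬ g ∣ T
  to (inj₁ H<0) = inj₁ (≰⇒> λ Q≤P → ℤ.<⇒≱ (subst (ℤ._< 0ℤ) (+-∸ Q≤P) H<0) (ℤ.+≤+ z≤n))
  to (inj₂ (H≡0 , g∤T)) = inj₂ (ℤ.+-injective (ℤ.i-j≡0⇒i≡j (+ P) (+ Q) H≡0) , g∤T ∘ ∣ᵤ⇒∣)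
  from : P < Q ⊎ P ≡ Q × ¬ g ∣ T → BadInteger (+ P ℤ.- + Q) (+ g) (+ T)
  from (inj₁ P<Q) = inj₁ (subst₂ ℤ._<_ (sym (ℤ.[+m]-[+n]≡m⊖n P Q)) (ℤ.n⊖n≡0 Q) (ℤ.⊖-monoˡ-< Q P<Q))
  from (inj₂ (P≡Q , g∤T)) = inj₂ (ℤ.i≡j⇒i-j≡0 (cong +_ P≡Q) , g∤T ∘ ∣⇒∣ᵤ)

indicator-cases : ∀ {P : Set} (P? : Dec P) →
  ∃[ e ] (if does P? then 1ℤ else 0ℤ) ≡ + e × (e ≡ 0 × ¬ P ⊎ e ≡ 1 × P)
indicator-cases (no ¬p) = 0 , refl , inj₁ (refl , ¬p)
indicator-cases (yes p) = 1 , refl , inj₂ (refl , p)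

corollary4p1 : (n m t a r : ℕ) → 1 ≤ n → (2≤m : 2 ≤ m) → (3≤t : 3 ≤ t) →
    2 ≤ a → a ≤ m ⊓ (t ∸ 1) → r ≡ m * t ∸ a →
    let open Parameters n m t r 2≤m 3≤t in
    (+ r ℤ.- 1ℤ) ℤ.* + n ℤ.- d ℤ.- ε ℤ.≥ threshold →
    ∃[ F ] (f[ n , r , suc t ]≡ F) × + F ≡ (+ r ℤ.- 1ℤ) ℤ.* + n ℤ.- d ℤ.- ε
corollary4p1 n (suc (suc m″)) (suc (suc (suc t′))) a zero 0<n 2≤m@(s≤s (s≤s _)) 3≤t@(s≤s (s≤s (s≤s _))) 2≤a a≤ r≡ large =
  -- r = 0 is impossible because a ≤ m < m t.
  contradiction (sym r≡) (m>n⇒m∸n≢0 (≤-<-trans (m≤n⊓o⇒m≤n (suc (suc m″)) (2 + t′) a≤)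
    (m<m*n (suc (suc m″)) (3 + t′) (s≤s (s≤s z≤n)))))
corollary4p1 n (suc (suc m″)) (suc (suc (suc t′))) a (suc r₁) 0<n 2≤m@(s≤s (s≤s _)) 3≤t@(s≤s (s≤s (s≤s _))) 2≤a a≤ r≡ large =
  F , extremal , F≡
  where
  open Parameters n (suc (suc m″)) (suc (suc (suc t′))) (suc r₁) 2≤m 3≤t
  m′ m t r K : ℕ
  m′ = suc m″
  m  = suc m′
  t  = 3 + t′
  r  = suc r₁
  K  = m′ * t + suc t′

  a≤m : a ≤ m
  a≤m = m≤n⊓o⇒m≤n m (2 + t′) a≤

  a<t : a < t
  a<t = s≤s (m≤n⊓o⇒m≤o m (2 + t′) a≤)

  r+a≡mt : r + a ≡ m * t
  r+a≡mt = trans (cong (_+ a) r≡) (m∸n+n≡m (≤-trans a≤m (m≤m*n m t)))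

  d-numerator : (+ m ℤ.- 1ℤ) ℤ.* (+ r ℤ.- 1ℤ) ℤ.* + n ≡ + (m′ * r₁ * n)
  d-numerator = trans (cong (ℤ._* + n) (sym (ℤ.pos-* m′ r₁))) (sym (ℤ.pos-* (m′ * r₁) n))

  d-data = ceiling-+ (m * t ∸ 2) d-numerator
  D = proj₁ d-data

  d≡ : d ≡ + D
  d≡ = proj₁ (proj₂ d-data)

  K≡ : m * t ∸ 2 ≡ K
  K≡ = identity m′ t′
    where
    identity : ∀ m t → suc (t + m * (3 + t)) ≡ m * (3 + t) + suc t
    identity = solve-∀

  d-lower : m′ * r₁ * n ≤ K * D
  d-lower = subst (λ K → m′ * r₁ * n ≤ K * D) K≡ (proj₁ (proj₂ (proj₂ d-data)))

  d-upper : K * D < m′ * r₁ * n + K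
  d-upper = subst (λ K → K * D < m′ * r₁ * n + K) K≡ (proj₂ (proj₂ (proj₂ d-data)))

  s≡ : s ≡ + (D / m′)
  s≡ = floor-+ m′ d≡

  T≡ : T ≡ + (D % m′)
  T≡ = begin
    d ℤ.- + m′ ℤ.* s                                    ≡⟨ cong₂ (λ d s → d ℤ.- + m′ ℤ.* s) d≡ s≡ ⟩
    + D ℤ.- + m′ ℤ.* + (D / m′)                         ≡⟨ cong (ℤ._-_ (+ D)) (ℤ.pos-* m′ (D / m′)) ⟨
    + D ℤ.- + (m′ * (D / m′))                           ≡⟨ +-∸ (≤-trans (≤-reflexive (*-comm m′ (D / m′))) (m/n*n≤m D m′)) ⟩
    + (D ∸ m′ * (D / m′))                               ≡⟨ cong +_ (trans (cong (D ∸_) (*-comm m′ (D / m′))) (sym (m%n≡m∸m/n*n D m′))) ⟩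
    + (D % m′)                                          ∎
    where open ≡-Reasoning

  P = n + t * D + suc t′ * (D / m′)

  H≡ : H ≡ + P ℤ.- + (r * n)
  H≡ = begin
    + n ℤ.+ + t ℤ.* d ℤ.+ + suc t′ ℤ.* s ℤ.- + r ℤ.* + n
      ≡⟨ cong₂ (λ d s → + n ℤ.+ + t ℤ.* d ℤ.+ + suc t′ ℤ.* s ℤ.- + r ℤ.* + n) d≡ s≡ ⟩
    + n ℤ.+ + t ℤ.* + D ℤ.+ + suc t′ ℤ.* + (D / m′) ℤ.- + r ℤ.* + n
      ≡⟨ cong₂ (λ x y → + n ℤ.+ x ℤ.+ y ℤ.- + r ℤ.* + n) (sym (ℤ.pos-* t D)) (sym (ℤ.pos-* (suc t′) (D / m′))) ⟩
    + P ℤ.- + r ℤ.* + n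
      ≡⟨ cong (ℤ._-_ (+ P)) (ℤ.pos-* r n) ⟨
    + P ℤ.- + (r * n) ∎
    where open ≡-Reasoning

  -- D ≤ m′ n gives s ≤ n, so the natural subtraction does not truncate.
  n-s≡ : D ≤ m′ * n → + n ℤ.- s ≡ + (n ∸ D / m′)
  n-s≡ D≤ = trans (cong (ℤ._-_ (+ n)) s≡) (+-∸ (*-cancelˡ-≤ m′
    (≤-trans (≤-reflexive (*-comm m′ (D / m′))) (≤-trans (m/n*n≤m D m′) D≤))))

  module Ex = Extremal {n} {m″} {t′} {a} {r₁} 0<n 2≤a a≤m a<t r+a≡mt

  ε-data = indicator-cases ((H ℤ.<? 0ℤ) ⊎-dec ((H ℤ.≟ 0ℤ) ×-dec ¬? ((+ n ℤ.- s) Signed.∣? T)))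
  e = proj₁ ε-data

  ε≡ : ε ≡ + e
  ε≡ = proj₁ (proj₂ ε-data)

  bad⇔′ = bad⇔ {P} {r * n} {n ∸ D / m′} {D % m′} H≡

  bad≡ : BadInteger H (+ n ℤ.- s) T ≡ BadInteger H (+ (n ∸ D / m′)) (+ (D % m′))
  bad≡ = cong₂ (BadInteger H) (n-s≡ (Ex.d≤ d-upper)) T≡

  ε-cases : Ex.Cases D e
  ε-cases with proj₂ (proj₂ ε-data)
  ... | inj₁ (e≡0 , ¬bad) = inj₁ (e≡0 , λ bad → ¬bad (subst (λ A → A) (sym bad≡) (proj₂ bad⇔′ bad)))
  ... | inj₂ (e≡1 , bad)  = inj₂ (e≡1 , proj₁ bad⇔′ (subst (λ A → A) bad≡ bad))

  A = (5 + 3 * t′) * (r * n)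
  θ = A / (3 * t ∸ 1)

  threshold≡ : threshold ≡ + θ
  threshold≡ = floor-+ (3 * t ∸ 1) (begin
    (+ 3 ℤ.* + t ℤ.- + 4) ℤ.* (+ r ℤ.* + n)
      ≡⟨ cong₂ (λ x y → (x ℤ.- + 4) ℤ.* y)
           (trans (sym (ℤ.pos-* 3 t)) (cong +_ (identity t′))) (sym (ℤ.pos-* r n)) ⟩
    (+ (9 + 3 * t′) ℤ.- + 4) ℤ.* + (r * n)
      ≡⟨ ℤ.pos-* (5 + 3 * t′) (r * n) ⟨
    + A ∎)
    where
    open ≡-Reasoning
    identity : ∀ t → 3 * (3 + t) ≡ 9 + 3 * t
    identity = solve-∀

  target≡ : (+ r ℤ.- 1ℤ) ℤ.* + n ℤ.- d ℤ.- ε ≡ + (r₁ * n) ℤ.- + (D + e)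
  target≡ = begin
    + r₁ ℤ.* + n ℤ.- d ℤ.- ε             ≡⟨ cong₂ (λ d ε → + r₁ ℤ.* + n ℤ.- d ℤ.- ε) d≡ ε≡ ⟩
    + r₁ ℤ.* + n ℤ.- + D ℤ.- + e         ≡⟨ cong (λ x → x ℤ.- + D ℤ.- + e) (ℤ.pos-* r₁ n) ⟨
    + (r₁ * n) ℤ.- + D ℤ.- + e           ≡⟨ ℤ.+-assoc (+ (r₁ * n)) (ℤ.- + D) (ℤ.- + e) ⟩
    + (r₁ * n) ℤ.+ (ℤ.- + D ℤ.- + e)     ≡⟨ cong (ℤ._+_ (+ (r₁ * n))) (ℤ.neg-distrib-+ (+ D) (+ e)) ⟨
    + (r₁ * n) ℤ.- + (D + e)             ∎
    where open ≡-Reasoning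

  θ≤ : + θ ℤ.≤ + (r₁ * n) ℤ.- + (D + e)
  θ≤ = subst₂ ℤ._≤_ threshold≡ target≡ large

  D+e≤ : D + e ≤ r₁ * n
  D+e≤ = ℤ.drop‿+≤+ (ℤ.0≤i-j⇒j≤i (ℤ.≤-trans (ℤ.+≤+ z≤n) θ≤))

  F = r₁ * n ∸ (D + e)

  F≡ : + F ≡ (+ r ℤ.- 1ℤ) ℤ.* + n ℤ.- d ℤ.- ε
  F≡ = sym (trans target≡ (+-∸ D+e≤))

  θ≤F : θ ≤ F
  θ≤F = ℤ.drop‿+≤+ (subst (ℤ._≤_ (+ θ)) (+-∸ D+e≤) θ≤)

  -- F is at least the floor of (3t - 4) r n / (3t - 1), so F + 1 lies strictly above the fraction
  -- itself. A minimum degree that beats F therefore meets the colouring criterion.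
  dense : 3 * (2 + t′) * (r * n) < (3 * (2 + t′) + 2) * suc F + r * n
  dense = begin-strict
    3 * (2 + t′) * (r * n)                  ≡⟨ split t′ (r * n) ⟩
    A + r * n                               <⟨ +-monoˡ-< (r * n) A< ⟩
    (3 * (2 + t′) + 2) * suc F + r * n      ∎
    where
    open ≤-Reasoning
    split : ∀ t x → 3 * (2 + t) * x ≡ (5 + 3 * t) * x + x
    split = solve-∀
    B≡ : 3 * t ∸ 1 ≡ 3 * (2 + t′) + 2
    B≡ = identity t′
      where
      identity : ∀ t → 2 + t + (3 + t + (3 + t + 0)) ≡ 3 * (2 + t) + 2
      identity = solve-∀
    A< : A < (3 * (2 + t′) + 2) * suc F
    A< = begin-strict
      A                                          ≡⟨ m≡m%n+[m/n]*n A (3 * t ∸ 1) ⟩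
      A % (3 * t ∸ 1) + θ * (3 * t ∸ 1)          <⟨ +-monoˡ-< (θ * (3 * t ∸ 1)) (m%n<n A (3 * t ∸ 1)) ⟩
      suc θ * (3 * t ∸ 1)                        ≤⟨ *-monoˡ-≤ (3 * t ∸ 1) (s≤s θ≤F) ⟩
      suc F * (3 * t ∸ 1)                        ≡⟨ *-comm (suc F) (3 * t ∸ 1) ⟩
      (3 * t ∸ 1) * suc F                        ≡⟨ cong (_* suc F) B≡ ⟩
      (3 * (2 + t′) + 2) * suc F                 ∎

  extremal : f[ n , r , suc t ]≡ F
  extremal = Ex.extremal d-lower d-upper ε-cases (m∸n+n≡m D+e≤) dense
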